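{- Let $n\geq 4$ be an integer and let $G$ be a unicyclic graph on $n$ vertices. Then $G$ has the maximum tenacity among all unicyclic graphs on $n$ vertices if and only if: (i) when $n$ is odd, $G$ is a cycle; (ii) when $n$ is even, the maximum degree of $G$ is at most $3$ and $G$ contains no two nonadjacent vertices of degree $3$.
   Context: All graphs are finite and simple. A unicyclic graph is a connected graph containing exactly one cycle. For a graph $G$, $\omega(G)$ denotes the number of components of $G$ and $\tau(G)$ the order of a largest component of $G$. The tenacity of a noncomplete connected graph $G$ is $T(G)=\min\left\{\frac{|X|+\tau(G-X)}{\omega(G-X)} : X\subset V(G),\ \omega(G-X)>1\right\}$. -}

module Defs where

open import Data.Bool using (Bool; true; false; _∧_; _∨_; not; if_then_else_)
open import Data.Nat using (ℕ; zero; suc; _+_; _∸_; _≤_; _<_; _≡ᵇ_; _<ᵇ_; _⊔_)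
open import Data.Fin using (Fin; toℕ)
open import Data.List using (List; []; _∷_; length; filter; map; foldr; concatMap)
open import Data.Bool.ListAction using (any)
open import Data.List.Base using (allFin)
open import Data.Product using (Σ; _×_; _,_; ∃)
open import Data.Integer using (+_)
open import Data.Rational.Unnormalised using (ℚᵘ; mkℚᵘ; _⊓_; 0ℚᵘ)
open import Data.Nat using (_<?_)
open import Data.Bool using () renaming (_≟_ to _≟ᵇ_)
open import Data.Fin using () renaming (_≟_ to _≟ᶠ_)
import Data.Fin as Fin
open import Data.Sum using (_⊎_)
open import Data.Rational.Unnormalised using () renaming (_≤_ to _≤ℚ_)
open import Function.Bundles using (_↔_; Inverse)
open import Relation.Binary.PropositionalEquality using (_≡_; _≢_)
open import Relation.Nullary using (¬_)
open import Relation.Nullary.Decidable using (⌊_⌋)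

record Graph (n : ℕ) : Set where
  field
    adj    : Fin n → Fin n → Bool
    sym    : ∀ u v → adj u v ≡ adj v u
    irrefl : ∀ v → adj v v ≡ false
open Graph public

VSet : ℕ → Set
VSet n = Fin n → Bool

count : ∀ {n} → VSet n → ℕ
count {n} P = length (filter (λ v → P v ≟ᵇ true) (allFin n))

degree : ∀ {n} → Graph n → Fin n → ℕ
degree G v = count (adj G v)

reachK : ∀ {n} → (Fin n → Fin n → Bool) → VSet n → ℕ → Fin n → Fin n → Bool
reachK {n} R A zero u v = ⌊ u ≟ᶠ v ⌋ ∧ A u
reachK {n} R A (suc k) u v =
  reachK R A k u v ∨ any (λ w → reachK R A k u w ∧ R w v ∧ A v) (allFin n)

-- reachability (walks of length ≤ n suffice on n vertices)
reach : ∀ {n} → (Fin n → Fin n → Bool) → VSet n → Fin n → Fin n → Bool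
reach {n} R A = reachK R A n

Connected : ∀ {n} → Graph n → Set
Connected {n} G = ∀ u v → reach (adj G) (λ _ → true) u v ≡ true

-- A cycle of G, represented by its edge set C (a subgraph):
-- C ⊆ E(G), C symmetric, every vertex has C-degree 0 or 2, some vertex has
-- C-degree 2, and the vertices of C-degree 2 are mutually connected through C.
record IsCycleIn {n : ℕ} (G : Graph n) (C : Fin n → Fin n → Bool) : Set where
  field
    sub      : ∀ u v → C u v ≡ true → adj G u v ≡ true
    csym     : ∀ u v → C u v ≡ C v u
    deg02    : ∀ v → (count (C v) ≡ 0) ⊎ (count (C v) ≡ 2)
    nonempty : ∃ λ v → count (C v) ≡ 2
    conn     : ∀ u v → count (C u) ≡ 2 → count (C v) ≡ 2 →
               reach C (λ w → count (C w) ≡ᵇ 2) u v ≡ true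

record Unicyclic {n : ℕ} (G : Graph n) : Set where
  field
    connected : Connected G
    hasCycle  : ∃ λ C → IsCycleIn G C
    unique    : ∀ C C' → IsCycleIn G C → IsCycleIn G C' → ∀ u v → C u v ≡ C' u v

outside : ∀ {n} → VSet n → VSet n
outside X v = not (X v)

-- ω(G - X): number of vertices outside X that are the least vertex of their component
ω : ∀ {n} → Graph n → VSet n → ℕ
ω {n} G X = count (λ v → outside X v ∧
  not (any (λ u → (toℕ u <ᵇ toℕ v) ∧ reach (adj G) (outside X) u v) (allFin n)))

-- τ(G - X): order of a largest component (0 if G - X is empty)
τ : ∀ {n} → Graph n → VSet n → ℕ
τ {n} G X = foldr _⊔_ 0 (map (λ v → count (reach (adj G) (outside X) v)) (allFin n))

subsets : (n : ℕ) → List (VSet n)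
subsets zero = (λ ()) ∷ []
subsets (suc n) = concatMap (λ S → ext false S ∷ ext true S ∷ []) (subsets n)
  where
  ext : Bool → VSet n → VSet (suc n)
  ext b S Fin.zero = b
  ext b S (Fin.suc i) = S i

-- (|X| + τ(G-X)) / ω(G-X), valid when ω ≥ 1  (denominator of mkℚᵘ is 1 + second arg)
ratio : ∀ {n} → Graph n → VSet n → ℚᵘ
ratio G X = mkℚᵘ (+ (count X + τ G X)) (ω G X ∸ 1)

cuts : ∀ {n} → Graph n → List (VSet n)
cuts {n} G = filter (λ X → 1 <? ω G X) (subsets n)

minList : List ℚᵘ → ℚᵘ
minList [] = 0ℚᵘ            -- only reached for complete graphs (not used here)
minList (q ∷ []) = q
minList (q ∷ r ∷ qs) = q ⊓ minList (r ∷ qs)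

tenacity : ∀ {n} → Graph n → ℚᵘ
tenacity G = minList (map (ratio G) (cuts G))

MaxTenacityUnicyclic : ∀ {n} → Graph n → Set
MaxTenacityUnicyclic {n} G =
  ∀ (H : Graph n) → Unicyclic H → tenacity H ≤ℚ tenacity G

cycleAdj : (n : ℕ) → Fin n → Fin n → Bool
cycleAdj n i j = step i j ∨ step j i
  where
  step : Fin n → Fin n → Bool
  step a b = (toℕ b ≡ᵇ suc (toℕ a)) ∨ ((toℕ a ≡ᵇ n ∸ 1) ∧ (toℕ b ≡ᵇ 0))

IsCycleGraph : ∀ {n} → Graph n → Set
IsCycleGraph {n} G = Σ (Fin n ↔ Fin n) λ σ →
  ∀ i j → adj G (Inverse.to σ i) (Inverse.to σ j) ≡ cycleAdj n i j

EvenCondition : ∀ {n} → Graph n → Set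
EvenCondition G =
  (∀ v → degree G v ≤ 3) ×
  (∀ u v → u ≢ v → degree G u ≡ 3 → degree G v ≡ 3 → adj G u v ≡ true)

{-# OPTIONS --safe #-}
module Submission where

-- Orient the cycle of a unicyclic graph cyclically and its trees towards the cycle: the edges become the pairs
-- {w, next w} for a function next without cycles of length at most 2, so deg x = 1 + |next⁻¹ x|.
--
-- Lower bound. Following next from a vertex of G - X one leaves into X, unless the whole cycle avoids X. Hence ω is at
-- most the number of w ∉ X with next w ∈ X, plus one for a component containing the cycle, for which τ ≥ 3. Under the
-- degree hypotheses this number is at most |X| (all degrees ≤ 2) or |X| + 1 (the even condition), which together with
-- |X| + ω + τ ≤ n + 1 and parity gives the bounds (n + 3)/(n - 1) and (n + 2)/n.
--
-- Upper bound. The distance to a cycle vertex z along next 2-colours G up to one edge at z, which yields an independent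
-- set of size at least ⌊n/2⌋; its complement is a cut attaining the bounds.
--
-- Strictness. Start with one vertex of degree ≥ 3 (n odd), or with one of degree ≥ 4 or two nonadjacent ones of degree 3
-- (n even), and keep deleting vertices of remaining degree ≥ 2. Each step deletes at least two edges, so when the rest is
-- a matching one has τ ≤ 2 and ω ≥ |X| + 1, respectively ω ≥ |X| + 2, because G has exactly n edges.

open import Defs
open import Data.Nat using (ℕ; zero; suc; _+_; _*_; _∸_; _≤_; _<_; z≤n; s≤s; _⊔_; _<ᵇ_; _<?_; _≤?_; _≡ᵇ_; _%_; _/_)
open import Data.Nat.DivMod using (m≡m%n+[m/n]*n)
open import Data.Nat.Properties
open import Data.Nat.Solver using (module +-*-Solver)
open import Data.Integer using (+≤+)
import Data.Integer as ℤ
import Data.Integer.Properties as ℤ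
open import Data.Rational.Unnormalised using (ℚᵘ; mkℚᵘ; *≤*) renaming (_≤_ to _≤ℚ_)
import Data.Rational.Unnormalised.Properties as ℚ
open import Data.Fin using (Fin; zero; suc; toℕ; fromℕ<; inject₁)
open import Data.Fin.Induction using (<-weakInduction)
open import Data.Fin.Properties using (toℕ-injective; toℕ<n; toℕ-fromℕ<; toℕ-inject₁; pigeonhole; injective⇒≤) renaming (_≟_ to _≟ᶠ_; suc-injective to Fsuc-injective; any? to anyFin?)
open import Data.Bool using (Bool; true; false; _∧_; _∨_; not; T) renaming (_≟_ to _≟ᵇ_)
open import Data.Bool.Properties using (not-involutive; ∧-identityʳ)
open import Data.Bool.ListAction using (any)
open import Data.List using (List; []; _∷_; length; filter; map; foldr; tabulate)
open import Data.List.Base using (allFin)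
open import Data.List.Properties using (map-cong)
open import Data.List.Membership.Propositional using (_∈_)
open import Data.List.Membership.Propositional.Properties using (∈-map⁺; ∈-map⁻; ∈-filter⁺; ∈-filter⁻; ∈-concatMap⁺)
import Data.List.Relation.Unary.Any as Any
open import Data.List.Relation.Unary.Any using (here; there)
open import Data.Product using (Σ; ∃; _×_; _,_; proj₁; proj₂)
open import Data.Sum using (_⊎_; inj₁; inj₂; [_,_]′)
open import Data.Empty using (⊥; ⊥-elim)
open import Function using (_∘_; id; case_of_)
open import Function.Bundles using (_⇔_; mk⇔; mk↔ₛ′; Inverse)
open import Relation.Nullary using (¬_; Dec; yes; no; contradiction; ¬?)
open import Relation.Nullary.Decidable using (⌊_⌋; _×-dec_; _⊎-dec_)
open import Relation.Binary.Definitions using (tri<; tri≈; tri>)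
open import Relation.Binary.PropositionalEquality using (_≡_; _≢_; refl; trans; cong; cong₂; subst; subst₂; module ≡-Reasoning) renaming (sym to ≡-sym)
open import Algebra.Properties.CommutativeMonoid.Sum +-0-commutativeMonoid using (sum; sum-cong-≗; ∑-distrib-+; ∑-comm)

-- Everything is compared with one number per parity, `extremal`: no unicyclic graph has larger
-- tenacity, and the cycle graph attains it for every n ≥ 4, so maximality of `G` amounts to
-- `extremal ≤ tenacity G`. Uniqueness of the cycle is an equality of edge sets, so it can be
-- exploited only by exhibiting another cycle. All cycles are therefore produced in one way, as the
-- orbit of a periodic point of a function that moves along edges and has no 2-cycles. Take an edge
-- zy of the cycle and a spanning tree of G - zy rooted at z. An edge outside the tree would yield a
-- cycle missing zy; hence there is none, and sending every other vertex to its parent and z to y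
-- gives `next`. For greedy deletion two edges per vertex is the break-even point: n - |X| vertices
-- with n - 2|X| edges form at least |X| components, and every edge lost beyond that adds one.

true≢false : ∀ {b} → b ≡ true → b ≡ false → ⊥
true≢false refl ()

bool-cases : ∀ b → b ≡ true ⊎ b ≡ false
bool-cases true  = inj₁ refl
bool-cases false = inj₂ refl

¬true⇒false : ∀ {b} → ¬ b ≡ true → b ≡ false
¬true⇒false {true}  h = ⊥-elim (h refl)
¬true⇒false {false} h = refl

not-true : ∀ {b} → not b ≡ true → b ≡ false
not-true {false} _ = refl

false-not : ∀ {b} → b ≡ false → not b ≡ true
false-not refl = refl

∧-intro : ∀ {a b} → a ≡ true → b ≡ true → a ∧ b ≡ true
∧-intro refl refl = refl

∧-left : ∀ {a b} → a ∧ b ≡ true → a ≡ true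
∧-left {true} _ = refl

∧-right : ∀ {a b} → a ∧ b ≡ true → b ≡ true
∧-right {true} h = h

∨-introˡ : ∀ {a b} → a ≡ true → a ∨ b ≡ true
∨-introˡ refl = refl

∨-introʳ : ∀ {a b} → b ≡ true → a ∨ b ≡ true
∨-introʳ {true}  _ = refl
∨-introʳ {false} h = h

∨-elim : ∀ {a b} → a ∨ b ≡ true → a ≡ true ⊎ b ≡ true
∨-elim {true}  _ = inj₁ refl
∨-elim {false} h = inj₂ h

bool-ext : ∀ {a b} → (a ≡ true → b ≡ true) → (b ≡ true → a ≡ true) → a ≡ b
bool-ext {true}  {b}     f g = ≡-sym (f refl)
bool-ext {false} {true}  f g = g refl
bool-ext {false} {false} f g = refl

infix 4 _==_
_==_ : ∀ {n} → Fin n → Fin n → Bool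
a == b = ⌊ a ≟ᶠ b ⌋

==⇒≡ : ∀ {n} {a b : Fin n} → (a == b) ≡ true → a ≡ b
==⇒≡ {a = a} {b} h with a ≟ᶠ b
... | yes p = p

==-refl : ∀ {n} (a : Fin n) → (a == a) ≡ true
==-refl a with a ≟ᶠ a
... | yes _ = refl
... | no ¬p = ⊥-elim (¬p refl)

≢⇒== : ∀ {n} {a b : Fin n} → a ≢ b → (a == b) ≡ false
≢⇒== a≢b = ¬true⇒false (a≢b ∘ ==⇒≡)

any-elim : ∀ {n} (f : Fin n → Bool) → any f (allFin n) ≡ true → ∃ λ i → f i ≡ true
any-elim f = go f id
  where
  go : ∀ {m n} (f : Fin m → Bool) (g : Fin n → Fin m) →
       any f (tabulate g) ≡ true → ∃ λ i → f i ≡ true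
  go {n = suc n} f g h with ∨-elim {f (g zero)} h
  ... | inj₁ p = g zero , p
  ... | inj₂ q = go f (g ∘ suc) q

any-intro : ∀ {n} (f : Fin n → Bool) i → f i ≡ true → any f (allFin n) ≡ true
any-intro f i = go f id i
  where
  go : ∀ {m n} (f : Fin m → Bool) (g : Fin n → Fin m) i → f (g i) ≡ true → any f (tabulate g) ≡ true
  go f g zero    h = ∨-introˡ h
  go f g (suc i) h = ∨-introʳ {f (g zero)} (go f (g ∘ suc) i h)

-- Cardinalities of vertex sets

ind : Bool → ℕ
ind true  = 1
ind false = 0

count-sum : ∀ {n} (P : VSet n) → count P ≡ sum (ind ∘ P)
count-sum P = go P id
  where
  go : ∀ {m n} (P : VSet m) (g : Fin n → Fin m) →
       length (filter (λ v → P v ≟ᵇ true) (tabulate g)) ≡ sum (λ i → ind (P (g i)))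
  go {n = zero}  P g = refl
  go {n = suc n} P g with P (g zero)
  ... | true  = cong suc (go P (g ∘ suc))
  ... | false = go P (g ∘ suc)

sum-mono : ∀ {n} {f g : Fin n → ℕ} → (∀ i → f i ≤ g i) → sum f ≤ sum g
sum-mono {zero}  h = z≤n
sum-mono {suc n} h = +-mono-≤ (h zero) (sum-mono (h ∘ suc))

ind-mono : ∀ {a b} → (a ≡ true → b ≡ true) → ind a ≤ ind b
ind-mono {false} h = z≤n
ind-mono {true}  h rewrite h refl = ≤-refl

count-cong : ∀ {n} {P Q : VSet n} → (∀ i → P i ≡ Q i) → count P ≡ count Q
count-cong {P = P} {Q} h =
  trans (count-sum P) (trans (sum-cong-≗ (λ i → cong ind (h i))) (≡-sym (count-sum Q)))

count-mono : ∀ {n} {P Q : VSet n} → (∀ i → P i ≡ true → Q i ≡ true) → count P ≤ count Q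
count-mono {P = P} {Q} h =
  subst₂ _≤_ (≡-sym (count-sum P)) (≡-sym (count-sum Q)) (sum-mono (λ i → ind-mono (h i)))

count-+ : ∀ {n} {P Q R : VSet n} → (∀ i → ind (P i) ≡ ind (Q i) + ind (R i)) →
          count P ≡ count Q + count R
count-+ {P = P} {Q} {R} h = begin
  count P                              ≡⟨ count-sum P ⟩
  sum (ind ∘ P)                        ≡⟨ sum-cong-≗ h ⟩
  sum (λ i → ind (Q i) + ind (R i))    ≡⟨ ∑-distrib-+ (ind ∘ Q) (ind ∘ R) ⟩
  sum (ind ∘ Q) + sum (ind ∘ R)        ≡⟨ cong₂ _+_ (count-sum Q) (count-sum R) ⟨
  count Q + count R                    ∎
  where open ≡-Reasoning

count-∪-≤ : ∀ {n} {P Q R : VSet n} → (∀ i → P i ≡ true → Q i ≡ true ⊎ R i ≡ true) →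
            count P ≤ count Q + count R
count-∪-≤ {P = P} {Q} {R} h =
  subst₂ _≤_ (≡-sym (count-sum P))
    (trans (∑-distrib-+ (ind ∘ Q) (ind ∘ R)) (≡-sym (cong₂ _+_ (count-sum Q) (count-sum R))))
    (sum-mono (λ i → pointwise (P i) (Q i) (R i) (h i)))
  where
  pointwise : ∀ p q r → (p ≡ true → q ≡ true ⊎ r ≡ true) → ind p ≤ ind q + ind r
  pointwise false q     r     h = z≤n
  pointwise true  true  r     h = s≤s z≤n
  pointwise true  false true  h = ≤-refl
  pointwise true  false false h with h refl
  ... | inj₁ ()
  ... | inj₂ ()

count-split : ∀ {n} (P Q : VSet n) →
              count P ≡ count (λ i → P i ∧ Q i) + count (λ i → P i ∧ not (Q i))
count-split P Q = count-+ (λ i → pointwise (P i) (Q i))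
  where
  pointwise : ∀ p q → ind p ≡ ind (p ∧ q) + ind (p ∧ not q)
  pointwise false q     = refl
  pointwise true  true  = refl
  pointwise true  false = refl

count-const : ∀ n b → count {n} (λ _ → b) ≡ ind b * n
count-const n b = trans (count-sum {n} _) (go n b)
  where
  go : ∀ n b → sum {n} (λ _ → ind b) ≡ ind b * n
  go zero    b = ≡-sym (*-zeroʳ (ind b))
  go (suc n) b = trans (cong (ind b +_) (go n b)) (≡-sym (*-suc (ind b) n))

count-full : ∀ {n} {P : VSet n} → (∀ i → P i ≡ true) → count P ≡ n
count-full {n} h = trans (count-cong h) (trans (count-const n true) (*-identityˡ n))

count-empty : ∀ {n} {P : VSet n} → (∀ i → P i ≡ false) → count P ≡ 0
count-empty {n} h = trans (count-cong h) (count-const n false)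

count-outside : ∀ {n} (X : VSet n) → count X + count (outside X) ≡ n
count-outside {n} X =
  trans (≡-sym (count-split (λ _ → true) X)) (count-full {P = λ (_ : Fin n) → true} (λ _ → refl))

count≤n : ∀ {n} (P : VSet n) → count P ≤ n
count≤n P = subst (count P ≤_) (count-outside P) (m≤m+n _ _)

count-singleton : ∀ {n} (a : Fin n) → count (a ==_) ≡ 1
count-singleton a = trans (count-sum (a ==_)) (go a)
  where
  shift : ∀ {n} (a i : Fin n) → (suc a == suc i) ≡ (a == i)
  shift a i with a ≟ᶠ i
  ... | yes _ = refl
  ... | no  _ = refl
  zeros : ∀ n → sum {n} (λ _ → 0) ≡ 0
  zeros zero    = refl
  zeros (suc n) = zeros n
  go : ∀ {n} (a : Fin n) → sum (λ i → ind (a == i)) ≡ 1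
  go {suc n} zero    = cong suc (zeros n)
  go {suc n} (suc a) = trans (sum-cong-≗ (λ i → cong ind (shift a i))) (go a)

infixl 7 _∖_
_∖_ : ∀ {n} → VSet n → Fin n → VSet n
(P ∖ a) i = P i ∧ not (a == i)

∖-intro : ∀ {n} {P : VSet n} {a i} → P i ≡ true → a ≢ i → (P ∖ a) i ≡ true
∖-intro Pi a≢i = ∧-intro Pi (cong not (≢⇒== a≢i))

∖-elim : ∀ {n} {P : VSet n} {a i} → (P ∖ a) i ≡ true → P i ≡ true × a ≢ i
∖-elim {P = P} {a} {i} h =
  ∧-left h , λ { refl → true≢false (==-refl a) (not-true (∧-right {P i} h)) }

count-remove : ∀ {n} (P : VSet n) a → P a ≡ true → count P ≡ suc (count (P ∖ a))
count-remove P a Pa = trans (count-+ pointwise) (cong (_+ count (P ∖ a)) (count-singleton a))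
  where
  pointwise : ∀ i → ind (P i) ≡ ind (a == i) + ind ((P ∖ a) i)
  pointwise i with a ≟ᶠ i
  ... | yes refl rewrite Pa = refl
  ... | no  _ with P i
  ...   | true  = refl
  ...   | false = refl

count-≤1+remove : ∀ {n} (P : VSet n) a → count P ≤ suc (count (P ∖ a))
count-≤1+remove P a with bool-cases (P a)
... | inj₁ Pa  = ≤-reflexive (count-remove P a Pa)
... | inj₂ ¬Pa = ≤-trans (count-mono {P = P} {P ∖ a}
    (λ i Pi → ∖-intro {P = P} Pi (λ { refl → true≢false Pi ¬Pa }))) (n≤1+n _)

-- The map may use the proof of membership, since several later uses extract the image from that
-- proof (markers of components, tails of edges). Induction on `m`, removing the image of `zero`
-- from `Q`.
count-injection : ∀ {m n} (P : VSet m) (Q : VSet n) (g : ∀ i → P i ≡ true → Fin n) →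
                  (∀ i p → Q (g i p) ≡ true) →
                  (∀ i j p q → g i p ≡ g j q → i ≡ j) → count P ≤ count Q
count-injection P Q g gQ inj = subst (_≤ count Q) (≡-sym (count-sum P)) (go P Q g gQ inj)
  where
  go : ∀ {m n} (P : VSet m) (Q : VSet n) (g : ∀ i → P i ≡ true → Fin n) →
       (∀ i p → Q (g i p) ≡ true) →
       (∀ i j p q → g i p ≡ g j q → i ≡ j) → sum (ind ∘ P) ≤ count Q
  go {zero}  P Q g gQ inj = z≤n
  go {suc m} P Q g gQ inj with bool-cases (P zero)
  ... | inj₂ ¬P0 rewrite ¬P0 =
    go (P ∘ suc) Q (g ∘ suc) (gQ ∘ suc) (λ i j p q e → Fsuc-injective (inj (suc i) (suc j) p q e))
  ... | inj₁ P0 = subst₂ _≤_ (cong (_+ sum (ind ∘ P ∘ suc)) (≡-sym (cong ind P0)))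
                         (≡-sym (count-remove Q (g zero P0) (gQ zero P0)))
    (s≤s (go (P ∘ suc) (Q ∖ g zero P0) (g ∘ suc)
      (λ i p → ∖-intro {P = Q} (gQ (suc i) p) (λ e → case inj zero (suc i) P0 p e of λ ()))
      (λ i j p q e → Fsuc-injective (inj (suc i) (suc j) p q e))))

count≥1 : ∀ {n} {P : VSet n} {a} → P a ≡ true → 1 ≤ count P
count≥1 {P = P} {a} Pa = subst (1 ≤_) (≡-sym (count-remove P a Pa)) (s≤s z≤n)

count≥2 : ∀ {n} {P : VSet n} {a b} → P a ≡ true → P b ≡ true → a ≢ b → 2 ≤ count P
count≥2 {P = P} {a} Pa Pb a≢b = subst (2 ≤_) (≡-sym (count-remove P a Pa))
  (s≤s (count≥1 {P = P ∖ a} (∖-intro {P = P} Pb a≢b)))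

count≥3 : ∀ {n} {P : VSet n} {a b c} → P a ≡ true → P b ≡ true → P c ≡ true →
          a ≢ b → a ≢ c → b ≢ c → 3 ≤ count P
count≥3 {P = P} {a} Pa Pb Pc a≢b a≢c b≢c = subst (3 ≤_) (≡-sym (count-remove P a Pa))
  (s≤s (count≥2 {P = P ∖ a} (∖-intro {P = P} Pb a≢b) (∖-intro {P = P} Pc a≢c) b≢c))

count≥1⇒∃ : ∀ {n} {P : VSet n} → 1 ≤ count P → ∃ λ i → P i ≡ true
count≥1⇒∃ {P = P} h with anyFin? (λ i → P i ≟ᵇ true)
... | yes e = e
... | no ¬e = contradiction (subst (1 ≤_) (count-empty (λ i → ¬true⇒false (λ p → ¬e (i , p)))) h) λ ()

count≥2⇒∃≢ : ∀ {n} {P : VSet n} → 2 ≤ count P → ∀ c → ∃ λ i → P i ≡ true × c ≢ i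
count≥2⇒∃≢ {P = P} h c with count≥1⇒∃ {P = P ∖ c} (≤-pred (≤-trans h (count-≤1+remove P c)))
... | i , p = i , ∖-elim {P = P} p

count≤1⇒≡ : ∀ {n} {P : VSet n} → count P ≤ 1 → ∀ {a b} → P a ≡ true → P b ≡ true → a ≡ b
count≤1⇒≡ {P = P} h {a} {b} Pa Pb with a ≟ᶠ b
... | yes e   = e
... | no  a≢b = contradiction (≤-trans (count≥2 {P = P} Pa Pb a≢b) h) λ { (s≤s ()) }

≡⇒count≤1 : ∀ {n} {P : VSet n} → (∀ {a b} → P a ≡ true → P b ≡ true → a ≡ b) → count P ≤ 1
≡⇒count≤1 {P = P} h with anyFin? (λ i → P i ≟ᵇ true)
... | no ¬e = subst (_≤ 1) (≡-sym (count-empty (λ i → ¬true⇒false (λ p → ¬e (i , p))))) z≤n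
... | yes (a , Pa) = subst (count P ≤_) (count-singleton a)
        (count-mono {P = P} {a ==_} (λ i Pi → subst (λ x → (a == x) ≡ true) (h Pa Pi) (==-refl a)))

count≤2 : ∀ {n} {P : VSet n} {a b} → (∀ i → P i ≡ true → a ≡ i ⊎ b ≡ i) → count P ≤ 2
count≤2 {P = P} {a} {b} h = subst (count P ≤_) (cong₂ _+_ (count-singleton a) (count-singleton b))
  (count-∪-≤ {P = P} (λ i Pi → case h i Pi of λ { (inj₁ refl) → inj₁ (==-refl a) ; (inj₂ refl) → inj₂ (==-refl b) }))

count-< : ∀ {n} {P Q : VSet n} {a} → (∀ i → P i ≡ true → Q i ≡ true) →
          P a ≡ false → Q a ≡ true → count P < count Q
count-< {P = P} {Q} {a} P⊆Q ¬Pa Qa = subst (count P <_) (≡-sym (count-remove Q a Qa))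
  (s≤s (count-mono {P = P} {Q ∖ a} (λ i Pi → ∖-intro {P = Q} (P⊆Q i Pi) (λ { refl → true≢false Pi ¬Pa }))))

⊆-count-≡ : ∀ {n} {P Q : VSet n} → (∀ i → P i ≡ true → Q i ≡ true) → count Q ≤ count P →
            ∀ i → P i ≡ Q i
⊆-count-≡ {P = P} {Q} P⊆Q h i = bool-ext (P⊆Q i) (λ Qi →
  case bool-cases (P i) of λ { (inj₁ Pi) → Pi
                             ; (inj₂ ¬Pi) → contradiction h (<⇒≱ (count-< {P = P} {Q} P⊆Q ¬Pi Qi)) })

-- Walks

-- Walks of any length, growing at the end as in `reachK`; concatenation and reversal then need no
-- bookkeeping of a length bound.
data Walk {n} (R : Fin n → Fin n → Bool) (A : VSet n) (u : Fin n) : Fin n → Set where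
  nil  : A u ≡ true → Walk R A u u
  snoc : ∀ {w v} → Walk R A u w → R w v ≡ true → A v ≡ true → Walk R A u v

module _ {n} {R : Fin n → Fin n → Bool} {A : VSet n} where

  walk-start : ∀ {u v} → Walk R A u v → A u ≡ true
  walk-start (nil Au)     = Au
  walk-start (snoc p _ _) = walk-start p

  walk-end : ∀ {u v} → Walk R A u v → A v ≡ true
  walk-end (nil Au)      = Au
  walk-end (snoc _ _ Av) = Av

  walk-++ : ∀ {u v w} → Walk R A u v → Walk R A v w → Walk R A u w
  walk-++ p (nil _)       = p
  walk-++ p (snoc q e Aw) = snoc (walk-++ p q) e Aw

  walk-edge : ∀ {u v} → A u ≡ true → R u v ≡ true → A v ≡ true → Walk R A u v
  walk-edge Au = snoc (nil Au)

  walk-sym : (∀ u v → R u v ≡ R v u) → ∀ {u v} → Walk R A u v → Walk R A v u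
  walk-sym R-sym (nil Au) = nil Au
  walk-sym R-sym (snoc {w} {v} p e Av) =
    walk-++ (walk-edge Av (trans (R-sym v w) e) (walk-end p)) (walk-sym R-sym p)

  walk-invariant : ∀ {P : Fin n → Set} → (∀ a b → P a → R a b ≡ true → A b ≡ true → P b) →
                   ∀ {u v} → P u → Walk R A u v → P v
  walk-invariant step Pu (nil _)      = Pu
  walk-invariant step Pu (snoc p e a) = step _ _ (walk-invariant step Pu p) e a

  reachK⇒walk : ∀ k {u v} → reachK R A k u v ≡ true → Walk R A u v
  reachK⇒walk zero {u} {v} h with ==⇒≡ {a = u} {v} (∧-left h)
  ... | refl = nil (∧-right {u == u} h)
  reachK⇒walk (suc k) {u} {v} h with ∨-elim {reachK R A k u v} h
  ... | inj₁ p = reachK⇒walk k p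
  ... | inj₂ q with any-elim _ q
  ...   | w , r = snoc (reachK⇒walk k (∧-left r)) (∧-left (∧-right {reachK R A k u w} r))
                       (∧-right {R w v} (∧-right {reachK R A k u w} r))

  reachK-suc : ∀ k {u v} → reachK R A k u v ≡ true → reachK R A (suc k) u v ≡ true
  reachK-suc k = ∨-introˡ

  reachK-step : ∀ k {u w v} → reachK R A k u w ≡ true → R w v ≡ true → A v ≡ true →
                reachK R A (suc k) u v ≡ true
  reachK-step k {u} {w} {v} p e a =
    ∨-introʳ {reachK R A k u v} (any-intro _ w (∧-intro p (∧-intro e a)))

  Saturated : ℕ → Fin n → Set
  Saturated k u = ∀ v → reachK R A (suc k) u v ≡ true → reachK R A k u v ≡ true

  saturated-suc : ∀ k {u} → Saturated k u → Saturated (suc k) u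
  saturated-suc k {u} sat v h with ∨-elim {reachK R A (suc k) u v} h
  ... | inj₁ p = p
  ... | inj₂ q with any-elim _ q
  ...   | w , r = reachK-step k (sat w (∧-left r)) (∧-left (∧-right {reachK R A (suc k) u w} r))
                    (∧-right {R w v} (∧-right {reachK R A (suc k) u w} r))

  -- A step that does not saturate reaches a new vertex, so k such steps reach at least `suc k`
  -- vertices, the start included.
  saturated-or-large : ∀ k {u} → A u ≡ true → Saturated k u ⊎ suc k ≤ count (reachK R A k u)
  saturated-or-large zero {u} Au =
    inj₂ (count≥1 {P = reachK R A 0 u} {u} (∧-intro (==-refl u) Au))
  saturated-or-large (suc k) {u} Au with saturated-or-large k {u} Au
  ... | inj₁ sat = inj₁ (saturated-suc k sat)
  ... | inj₂ large with anyFin? (λ v → (reachK R A (suc k) u v ≟ᵇ true) ×-dec (reachK R A k u v ≟ᵇ false))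
  ...   | yes (v , new , old) =
    inj₂ (≤-trans (s≤s large)
      (count-< {P = reachK R A k u} {reachK R A (suc k) u} (λ _ → reachK-suc k) old new))
  ...   | no ¬new = inj₁ (saturated-suc k (λ v h →
          case bool-cases (reachK R A k u v) of λ { (inj₁ p) → p ; (inj₂ q) → ⊥-elim (¬new (v , h , q)) }))

  reachK-start : ∀ k {u} → A u ≡ true → reachK R A k u u ≡ true
  reachK-start zero {u} Au = ∧-intro (==-refl u) Au
  reachK-start (suc k)  Au = reachK-suc k (reachK-start k Au)

  -- With n steps the reached set can no longer grow: otherwise it would have more than n elements.
  walk⇒reach : ∀ {u v} → Walk R A u v → reach R A u v ≡ true
  walk⇒reach (nil Au) = reachK-start n Au
  walk⇒reach {u} {v} (snoc {w} p e Av) with saturated-or-large n {u} (walk-start p)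
  ... | inj₁ sat   = sat v (reachK-step n (walk⇒reach p) e Av)
  ... | inj₂ large = contradiction (≤-trans large (count≤n (reachK R A n u))) (<-irrefl refl)

-- Vertex sets are functions, and `subsets n` contains a given one only up to pointwise equality;
-- this congruence carries `ω`, `τ` and `ratio` over to the listed copy.
reachK-cong : ∀ {n} (R : Fin n → Fin n → Bool) {A B : VSet n} → (∀ i → A i ≡ B i) →
              ∀ k {u v} → reachK R A k u v ≡ true → reachK R B k u v ≡ true
reachK-cong R A≗B zero    {u} {v} h = ∧-intro (∧-left {u == v} h) (trans (≡-sym (A≗B u)) (∧-right {u == v} h))
reachK-cong R {A} {B} A≗B (suc k) {u} {v} h with ∨-elim {reachK R A k u v} h
... | inj₁ p = reachK-suc {R = R} {B} k (reachK-cong R A≗B k p)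
... | inj₂ q with any-elim _ q
...   | w , r = reachK-step {R = R} {B} k (reachK-cong R A≗B k (∧-left r)) (∧-left (∧-right {reachK R A k u w} r))
                  (trans (≡-sym (A≗B v)) (∧-right {R w v} (∧-right {reachK R A k u w} r)))

reach-cong : ∀ {n} (R : Fin n → Fin n → Bool) {A B : VSet n} → (∀ i → A i ≡ B i) →
             ∀ u v → reach R A u v ≡ reach R B u v
reach-cong {n} R A≗B u v =
  bool-ext (reachK-cong R A≗B n) (reachK-cong R (λ i → ≡-sym (A≗B i)) n)

-- Components of G - X

<ᵇ-true⇒< : ∀ {m n} → (m <ᵇ n) ≡ true → m < n
<ᵇ-true⇒< {m} {n} h = <ᵇ⇒< m n (subst T (≡-sym h) _)

<⇒<ᵇ-true : ∀ {m n} → m < n → (m <ᵇ n) ≡ true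
<⇒<ᵇ-true {m} {n} h with m <ᵇ n | <⇒<ᵇ h
... | true | _ = refl

max : ∀ {n} → (Fin n → ℕ) → ℕ
max {n} f = foldr _⊔_ 0 (map f (allFin n))

f≤max : ∀ {n} (f : Fin n → ℕ) i → f i ≤ max f
f≤max f i = go f id i
  where
  go : ∀ {m n} (f : Fin m → ℕ) (g : Fin n → Fin m) i → f (g i) ≤ foldr _⊔_ 0 (map f (tabulate g))
  go f g zero    = m≤m⊔n _ _
  go f g (suc i) = ≤-trans (go f (g ∘ suc) i) (m≤n⊔m (f (g zero)) _)

max≤ : ∀ {n} (f : Fin n → ℕ) {b} → (∀ i → f i ≤ b) → max f ≤ b
max≤ f h = go f id h
  where
  go : ∀ {m n} (f : Fin m → ℕ) (g : Fin n → Fin m) {b} → (∀ i → f i ≤ b) →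
       foldr _⊔_ 0 (map f (tabulate g)) ≤ b
  go {n = zero}  f g h = z≤n
  go {n = suc n} f g h = ⊔-lub (h (g zero)) (go f (g ∘ suc) h)

module Components {n} (G : Graph n) (X : VSet n) where

  A : VSet n
  A = outside X

  connects : Fin n → Fin n → Bool
  connects = reach (adj G) A

  below : Fin n → Fin n → Bool
  below v u = (toℕ u <ᵇ toℕ v) ∧ connects u v

  -- Unfolds to the very predicate counted in `ω`, so `ω G X` is `count least` by computation.
  least : VSet n
  least v = A v ∧ not (any (below v) (allFin n))

  to-walk : ∀ {u v} → connects u v ≡ true → Walk (adj G) A u v
  to-walk = reachK⇒walk n

  of-walk : ∀ {u v} → Walk (adj G) A u v → connects u v ≡ true
  of-walk = walk⇒reach

  connects-sym : ∀ {u v} → connects u v ≡ true → connects v u ≡ true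
  connects-sym h = of-walk (walk-sym (Graph.sym G) (to-walk h))

  connects-trans : ∀ {u v w} → connects u v ≡ true → connects v w ≡ true → connects u w ≡ true
  connects-trans p q = of-walk (walk-++ (to-walk p) (to-walk q))

  least-outside : ∀ {v} → least v ≡ true → A v ≡ true
  least-outside = ∧-left

  least-minimal : ∀ {u v} → least v ≡ true → connects u v ≡ true → ¬ toℕ u < toℕ v
  least-minimal {u} {v} l c u<v =
    true≢false (any-intro (below v) u (∧-intro (<⇒<ᵇ-true u<v) c)) (not-true (∧-right {A v} l))

  least-unique : ∀ {u v} → least u ≡ true → least v ≡ true → connects u v ≡ true → u ≡ v
  least-unique {u} {v} lu lv c with <-cmp (toℕ u) (toℕ v)
  ... | tri< u<v _ _ = ⊥-elim (least-minimal lv c u<v)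
  ... | tri≈ _ e _   = toℕ-injective e
  ... | tri> _ _ v<u = ⊥-elim (least-minimal lu (connects-sym c) v<u)

  least-or-below : ∀ {v} → A v ≡ true →
                   least v ≡ true ⊎ ∃ λ u → toℕ u < toℕ v × connects u v ≡ true
  least-or-below {v} Av with bool-cases (any (below v) (allFin n))
  ... | inj₂ none = inj₁ (∧-intro Av (false-not none))
  ... | inj₁ some with any-elim (below v) some
  ...   | u , h = inj₂ (u , <ᵇ-true⇒< (∧-left h) , ∧-right {toℕ u <ᵇ toℕ v} h)

  -- Least vertices of different components have their markers in different components, so choosing
  -- a marker is injective.
  ω≤ : ∀ (M : VSet n) →
       (∀ v → least v ≡ true → ∃ λ w → M w ≡ true × connects v w ≡ true) → ω G X ≤ count M
  ω≤ M marker = count-injection least M (λ v l → proj₁ (marker v l))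
    (λ v l → proj₁ (proj₂ (marker v l)))
    (λ u v lu lv e → least-unique lu lv
      (connects-trans (proj₂ (proj₂ (marker u lu)))
        (subst (λ w → connects w v ≡ true) (≡-sym e) (connects-sym (proj₂ (proj₂ (marker v lv)))))))

  ω≤outside : ω G X ≤ count A
  ω≤outside = count-mono {P = least} {A} (λ _ → ∧-left)

  component≤τ : ∀ v → count (connects v) ≤ τ G X
  component≤τ = f≤max (λ v → count (connects v))

  τ≤ : ∀ {b} → (∀ v → count (connects v) ≤ b) → τ G X ≤ b
  τ≤ = max≤ (λ v → count (connects v))

  -- A largest component contributes τ vertices but a single least one.
  ω+component≤ : ∀ v → ω G X + count (connects v) ≤ suc (count A)
  ω+component≤ v = begin
    ω G X + count K                                           ≡⟨ cong (_+ count K) (count-split least K) ⟩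
    count (λ i → least i ∧ K i) + count (λ i → least i ∧ not (K i)) + count K
      ≤⟨ +-monoˡ-≤ (count K) (+-mono-≤ one rest) ⟩
    1 + count (λ i → A i ∧ not (K i)) + count K               ≡⟨ cong suc (+-comm _ (count K)) ⟩
    1 + (count K + count (λ i → A i ∧ not (K i)))             ≤⟨ s≤s (+-monoˡ-≤ _ inside) ⟩
    1 + (count (λ i → A i ∧ K i) + count (λ i → A i ∧ not (K i))) ≡⟨ cong suc (count-split A K) ⟨
    suc (count A) ∎
    where
    open ≤-Reasoning
    K : VSet n
    K = connects v
    one : count (λ i → least i ∧ K i) ≤ 1
    one = ≡⇒count≤1 {P = λ i → least i ∧ K i} (λ {a} {b} p q →
      least-unique (∧-left p) (∧-left q)
        (connects-trans (connects-sym (∧-right {least a} p)) (∧-right {least b} q)))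
    rest : count (λ i → least i ∧ not (K i)) ≤ count (λ i → A i ∧ not (K i))
    rest = count-mono {P = λ i → least i ∧ not (K i)} {λ i → A i ∧ not (K i)}
      (λ i h → ∧-intro (∧-left {A i} (∧-left h)) (∧-right {least i} h))
    inside : count K ≤ count (λ i → A i ∧ K i)
    inside = count-mono {P = K} {λ i → A i ∧ K i} (λ i h → ∧-intro (walk-end (to-walk h)) h)

  -- `τ≤` wants a bound on a single component, so `ω G X` is moved across by truncated subtraction,
  -- which is exact because of `ω≤1+A`.
  |X|+ω+τ≤1+n : count X + (ω G X + τ G X) ≤ suc n
  |X|+ω+τ≤1+n = begin
    count X + (ω G X + τ G X)  ≤⟨ +-monoʳ-≤ (count X) (+-monoʳ-≤ (ω G X) (τ≤ component)) ⟩
    count X + (ω G X + (suc (count A) ∸ ω G X))  ≡⟨ cong (count X +_) (m+[n∸m]≡n ω≤1+A) ⟩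
    count X + suc (count A)    ≡⟨ +-suc (count X) (count A) ⟩
    suc (count X + count A)    ≡⟨ cong suc (count-outside X) ⟩
    suc n ∎
    where
    open ≤-Reasoning
    ω≤1+A : ω G X ≤ suc (count A)
    ω≤1+A = ≤-trans ω≤outside (n≤1+n _)
    component : ∀ v → count (connects v) ≤ suc (count A) ∸ ω G X
    component v = m+n≤o⇒m≤o∸n _ (subst (_≤ suc (count A)) (+-comm (ω G X) _) (ω+component≤ v))

  |X|+ω≤n : count X + ω G X ≤ n
  |X|+ω≤n = subst (count X + ω G X ≤_) (count-outside X) (+-monoʳ-≤ (count X) ω≤outside)

  ω≥1⇒τ≥1 : 1 ≤ ω G X → 1 ≤ τ G X
  ω≥1⇒τ≥1 h with count≥1⇒∃ {P = least} h
  ... | v , l = ≤-trans (count≥1 {P = connects v} {v} (of-walk (nil (least-outside l)))) (component≤τ v)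

  τ≤1⇒n≤|X|+ω : τ G X ≤ 1 → n ≤ count X + ω G X
  τ≤1⇒n≤|X|+ω h = subst (_≤ count X + ω G X) (count-outside X)
    (+-monoʳ-≤ (count X) (count-mono {P = A} {least} outside⇒least))
    where
    outside⇒least : ∀ v → A v ≡ true → least v ≡ true
    outside⇒least v Av with least-or-below Av
    ... | inj₁ l = l
    -- `u` and `v` would be two vertices of one component, against `τ G X ≤ 1`.
    ... | inj₂ (u , u<v , c) = ⊥-elim (<-irrefl (cong toℕ
            (count≤1⇒≡ {P = connects u} (≤-trans (component≤τ u) h)
              (of-walk (nil (walk-start (to-walk c)))) c)) u<v)

-- Tenacity as a minimum

module _ {n} (G : Graph n) {X Y : VSet n} (X≗Y : ∀ i → X i ≡ Y i) where

  private
    connects≗ : ∀ u v → reach (adj G) (outside X) u v ≡ reach (adj G) (outside Y) u v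
    connects≗ = reach-cong (adj G) (λ i → cong not (X≗Y i))

  any-cong : ∀ {f g : Fin n → Bool} → (∀ i → f i ≡ g i) → any f (allFin n) ≡ any g (allFin n)
  any-cong h = cong (foldr _∨_ false) (map-cong h (allFin n))

  ω-cong : ω G X ≡ ω G Y
  ω-cong = count-cong (λ v → cong₂ _∧_ (cong not (X≗Y v))
    (cong not (any-cong (λ u → cong ((toℕ u <ᵇ toℕ v) ∧_) (connects≗ u v)))))

  τ-cong : τ G X ≡ τ G Y
  τ-cong = cong (foldr _⊔_ 0) (map-cong (λ v → count-cong (connects≗ v)) (allFin n))

  ratio-cong : ratio G X ≡ ratio G Y
  ratio-cong = cong₂ mkℚᵘ (cong ℤ.+_ (cong₂ _+_ (count-cong X≗Y) τ-cong)) (cong (_∸ 1) ω-cong)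

subsets-complete : ∀ n (X : VSet n) → ∃ λ Y → Y ∈ subsets n × (∀ i → X i ≡ Y i)
subsets-complete zero    X = (λ ()) , here refl , λ ()
subsets-complete (suc n) X with subsets-complete n (X ∘ suc)
... | Y , Y∈ , X≗Y with bool-cases (X zero)
...   | inj₁ X0 = _ , ∈-concatMap⁺ _ {xs = subsets n} (Any.map (λ { refl → there (here refl) }) Y∈) ,
                  λ { zero → X0 ; (suc i) → X≗Y i }
...   | inj₂ X0 = _ , ∈-concatMap⁺ _ {xs = subsets n} (Any.map (λ { refl → here refl }) Y∈) ,
                  λ { zero → X0 ; (suc i) → X≗Y i }

minList≤ : ∀ {q} qs → q ∈ qs → minList qs ≤ℚ q
minList≤ (q ∷ [])     (here refl) = ℚ.≤-refl
minList≤ (q ∷ r ∷ qs) (here refl) = ℚ.p⊓q≤p q (minList (r ∷ qs))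
minList≤ (q ∷ r ∷ qs) (there p)   = ℚ.≤-trans (ℚ.p⊓q≤q q (minList (r ∷ qs))) (minList≤ (r ∷ qs) p)

-- The member `q` rules out the empty list, on which `minList` takes its default value 0.
≤minList : ∀ {p q} qs → q ∈ qs → (∀ {r} → r ∈ qs → p ≤ℚ r) → p ≤ℚ minList qs
≤minList (q ∷ [])     _ h = h (here refl)
≤minList (q ∷ r ∷ qs) _ h = ℚ.⊓-glb (h (here refl)) (≤minList (r ∷ qs) (here refl) (h ∘ there))

module _ {n} (G : Graph n) where

  cuts-complete : ∀ X → 1 < ω G X → ratio G X ∈ map (ratio G) (cuts G)
  cuts-complete X 1<ω with subsets-complete n X
  ... | Y , Y∈ , X≗Y = subst (_∈ map (ratio G) (cuts G)) (≡-sym (ratio-cong G X≗Y))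
    (∈-map⁺ (ratio G) (∈-filter⁺ (λ Z → 1 <? ω G Z) Y∈ (subst (1 <_) (ω-cong G X≗Y) 1<ω)))

  tenacity≤ratio : ∀ X → 1 < ω G X → tenacity G ≤ℚ ratio G X
  tenacity≤ratio X 1<ω = minList≤ _ (cuts-complete X 1<ω)

  ≤tenacity : ∀ {q} X → 1 < ω G X → (∀ Y → 1 < ω G Y → q ≤ℚ ratio G Y) → q ≤ℚ tenacity G
  ≤tenacity {q} X 1<ω h = ≤minList _ (cuts-complete X 1<ω) bound
    where
    bound : ∀ {r} → r ∈ map (ratio G) (cuts G) → q ≤ℚ r
    bound r∈ with ∈-map⁻ (ratio G) r∈
    ... | Y , Y∈ , refl = h Y (proj₂ (∈-filter⁻ (λ Z → 1 <? ω G Z) {xs = subsets n} Y∈))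

-- The denominator is encoded as in `ratio`, so `ratio G X` is `frac (count X + τ G X) (ω G X)` by
-- definition. A denominator 0 would be read as 1, whence the positivity hypotheses below.
frac : ℕ → ℕ → ℚᵘ
frac a b = mkℚᵘ (ℤ.+ a) (b ∸ 1)

frac-≤ : ∀ {a b c d} → 1 ≤ b → 1 ≤ d → a * d ≤ c * b → frac a b ≤ℚ frac c d
frac-≤ {a} {suc b} {c} {suc d} _ _ h =
  *≤* (subst₂ ℤ._≤_ (ℤ.pos-* a (suc d)) (ℤ.pos-* c (suc b)) (+≤+ h))

frac-≤⁻¹ : ∀ {a b c d} → 1 ≤ b → 1 ≤ d → frac a b ≤ℚ frac c d → a * d ≤ c * b
frac-≤⁻¹ {a} {suc b} {c} {suc d} _ _ (*≤* h) =
  ℤ.drop‿+≤+ (subst₂ ℤ._≤_ (≡-sym (ℤ.pos-* a (suc d))) (≡-sym (ℤ.pos-* c (suc b))) h)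

-- Cycles of functional graphs

iter : ∀ {A : Set} → (A → A) → ℕ → A → A
iter f zero    x = x
iter f (suc k) x = f (iter f k x)

iter-+ : ∀ {A : Set} (f : A → A) m k x → iter f (m + k) x ≡ iter f m (iter f k x)
iter-+ f zero    k x = refl
iter-+ f (suc m) k x = cong f (iter-+ f m k x)

iter-suc : ∀ {A : Set} (f : A → A) k x → iter f k (f x) ≡ f (iter f k x)
iter-suc f zero    x = refl
iter-suc f (suc k) x = cong f (iter-suc f k x)

iter-periodic : ∀ {n} (f : Fin n → Fin n) x₀ →
                ∃ λ i → ∃ λ d → iter f (suc d) (iter f i x₀) ≡ iter f i x₀
iter-periodic {n} f x₀ with pigeonhole (n<1+n n) (λ k → iter f (toℕ k) x₀)
... | i , j , i<j , e = toℕ i , toℕ j ∸ suc (toℕ i) ,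
  trans (≡-sym (iter-+ f (suc (toℕ j ∸ suc (toℕ i))) (toℕ i) x₀))
    (trans (cong (λ k → iter f k x₀) (trans (≡-sym (+-suc _ (toℕ i))) (m∸n+n≡m i<j))) (≡-sym e))

-- On the orbit of a periodic point `f` is a bijection with inverse `iter f d`, so the neighbours of
-- `u` along the orbit are exactly `f u` and `g u`. They differ because `f` has no 2-cycles, which
-- excludes fixed points as well.
module FunctionalCycle {n} (G : Graph n) (K : VSet n) (f : Fin n → Fin n)
  (f-in : ∀ v → K v ≡ true → K (f v) ≡ true)
  (f-adj : ∀ v → K v ≡ true → adj G v (f v) ≡ true)
  (f-no-2-cycle : ∀ v → K v ≡ true → f (f v) ≢ v)
  (x : Fin n) (Kx : K x ≡ true) (d : ℕ) (period : iter f (suc d) x ≡ x) where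

  hits : Fin n → Fin (suc d) → Bool
  hits w k = iter f (toℕ k) x == w

  Orbit : VSet n
  Orbit w = any (hits w) (allFin (suc d))

  orbit-elim : ∀ {w} → Orbit w ≡ true → ∃ λ k → iter f k x ≡ w
  orbit-elim {w} h with any-elim (hits w) h
  ... | k , p = toℕ k , ==⇒≡ p

  orbit-iter : ∀ k → Orbit (iter f k x) ≡ true
  orbit-iter zero    = any-intro (hits x) zero (==-refl x)
  orbit-iter (suc k) with any-elim (hits (iter f k x)) (orbit-iter k)
  ... | i , p with ==⇒≡ p | suc (toℕ i) <? suc d
  ...   | e | yes i< = any-intro (hits (f (iter f k x))) (fromℕ< i<)
            (subst (λ w → (w == f (iter f k x)) ≡ true)
              (trans (cong f (≡-sym e)) (cong (λ j → iter f j x) (≡-sym (toℕ-fromℕ< i<))))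
              (==-refl _))
  -- The index is `d` here, and one more step wraps around to `x`.
  ...   | e | no i≮ = any-intro (hits (f (iter f k x))) zero
            (subst (λ w → (x == w) ≡ true)
              (trans (≡-sym period) (trans (cong (λ j → iter f (suc j) x) d≡i) (cong f e)))
              (==-refl x))
    where
    d≡i : d ≡ toℕ i
    d≡i = ≤-antisym (≤-pred (≤-pred (≰⇒> i≮))) (≤-pred (toℕ<n i))

  orbit-in : ∀ {w} → Orbit w ≡ true → K w ≡ true
  orbit-in h with orbit-elim h
  ... | k , refl = go k
    where
    go : ∀ k → K (iter f k x) ≡ true
    go zero    = Kx
    go (suc k) = f-in _ (go k)

  orbit-f : ∀ {w} → Orbit w ≡ true → Orbit (f w) ≡ true
  orbit-f h with orbit-elim h
  ... | k , refl = orbit-iter (suc k)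

  g : Fin n → Fin n
  g = iter f d

  gf : ∀ {w} → Orbit w ≡ true → g (f w) ≡ w
  gf h with orbit-elim h
  ... | k , refl = begin
    iter f d (iter f (suc k) x)  ≡⟨ iter-+ f d (suc k) x ⟨
    iter f (d + suc k) x         ≡⟨ cong (λ j → iter f j x) (trans (+-suc d k) (+-comm (suc d) k)) ⟩
    iter f (k + suc d) x         ≡⟨ iter-+ f k (suc d) x ⟩
    iter f k (iter f (suc d) x)  ≡⟨ cong (iter f k) period ⟩
    iter f k x                   ∎
    where open ≡-Reasoning

  fg : ∀ {w} → Orbit w ≡ true → f (g w) ≡ w
  fg {w} h = trans (≡-sym (iter-suc f d w)) (gf h)

  orbit-g : ∀ {w} → Orbit w ≡ true → Orbit (g w) ≡ true
  orbit-g h with orbit-elim h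
  ... | k , refl = subst (λ w → Orbit w ≡ true) (iter-+ f d k x) (orbit-iter (d + k))

  C : Fin n → Fin n → Bool
  C u v = Orbit u ∧ (Orbit v ∧ ((f u == v) ∨ (f v == u)))

  C-left : ∀ {u v} → C u v ≡ true → Orbit u ≡ true
  C-left = ∧-left

  C-right : ∀ {u v} → C u v ≡ true → Orbit v ≡ true
  C-right {u} h = ∧-left (∧-right {Orbit u} h)

  C-edge : ∀ {u v} → C u v ≡ true → f u ≡ v ⊎ f v ≡ u
  C-edge {u} {v} h with ∨-elim {f u == v} (∧-right {Orbit v} (∧-right {Orbit u} h))
  ... | inj₁ p = inj₁ (==⇒≡ p)
  ... | inj₂ q = inj₂ (==⇒≡ q)

  C-intro : ∀ {u v} → Orbit u ≡ true → Orbit v ≡ true → f u ≡ v ⊎ f v ≡ u → C u v ≡ true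
  C-intro {u} {v} p q (inj₁ refl) = ∧-intro p (∧-intro q (∨-introˡ (==-refl v)))
  C-intro {u} {v} p q (inj₂ refl) = ∧-intro p (∧-intro q (∨-introʳ {f u == v} (==-refl u)))

  C-sym : ∀ {u v} → C u v ≡ true → C v u ≡ true
  C-sym h = C-intro (C-right h) (C-left h) ([ inj₂ , inj₁ ]′ (C-edge h))

  degree-in : ∀ u → Orbit u ≡ true → count (C u) ≡ 2
  degree-in u h = ≤-antisym
    (count≤2 {P = C u} {f u} {g u} (λ v c → case C-edge c of λ
      { (inj₁ e) → inj₁ e
      ; (inj₂ e) → inj₂ (trans (cong g (≡-sym e)) (gf (C-right c))) }))
    (count≥2 {P = C u} {f u} {g u} (C-intro h (orbit-f h) (inj₁ refl)) (C-intro h (orbit-g h) (inj₂ (fg h)))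
      (λ e → f-no-2-cycle u (orbit-in h) (trans (cong f e) (fg h))))

  degree-out : ∀ u → Orbit u ≡ false → count (C u) ≡ 0
  degree-out u h = count-empty {P = C u} (λ v → ¬true⇒false (λ c → true≢false (C-left {u} {v} c) h))

  degree-2⇒orbit : ∀ {u} → count (C u) ≡ 2 → Orbit u ≡ true
  degree-2⇒orbit {u} h with bool-cases (Orbit u)
  ... | inj₁ p = p
  ... | inj₂ q with trans (≡-sym h) (degree-out u q)
  ...   | ()

  OnC : VSet n
  OnC w = count (C w) ≡ᵇ 2

  on-C : ∀ {w} → Orbit w ≡ true → OnC w ≡ true
  on-C {w} h rewrite degree-in w h = refl

  walk-from-x : ∀ {w} → Orbit w ≡ true → Walk C OnC x w
  walk-from-x h with orbit-elim h
  ... | k , refl = go k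
    where
    go : ∀ k → Walk C OnC x (iter f k x)
    go zero    = nil (on-C (orbit-iter 0))
    go (suc k) = snoc (go k) (C-intro (orbit-iter k) (orbit-iter (suc k)) (inj₁ refl)) (on-C (orbit-iter (suc k)))

  isCycle : IsCycleIn G C
  isCycle = record
    { sub      = λ u v c → case C-edge c of λ
        { (inj₁ refl) → f-adj u (orbit-in (C-left c))
        ; (inj₂ refl) → trans (Graph.sym G _ _) (f-adj v (orbit-in (C-right c))) }
    ; csym     = λ u v → bool-ext C-sym C-sym
    ; deg02    = λ v → case bool-cases (Orbit v) of λ
        { (inj₁ p) → inj₂ (degree-in v p) ; (inj₂ q) → inj₁ (degree-out v q) }
    ; nonempty = x , degree-in x (orbit-iter 0)
    ; conn     = λ u v p q → walk⇒reach (walk-++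
        (walk-sym (λ a b → bool-ext C-sym C-sym) (walk-from-x (degree-2⇒orbit p)))
        (walk-from-x (degree-2⇒orbit q)))
    }

abstract
  -- Iterating from `x` runs into a periodic point by the pigeonhole principle. The last clause
  -- confines the cycle to edges of `f` inside `K`; it shows that a cycle found within a subgraph of
  -- `G` stays there.
  functional-cycle : ∀ {n} (G : Graph n) (K : VSet n) (f : Fin n → Fin n) →
    (∀ v → K v ≡ true → K (f v) ≡ true) →
    (∀ v → K v ≡ true → adj G v (f v) ≡ true) →
    (∀ v → K v ≡ true → f (f v) ≢ v) →
    ∀ x → K x ≡ true →
    ∃ λ C → IsCycleIn G C ×
            (∀ u v → C u v ≡ true → (K u ≡ true × f u ≡ v) ⊎ (K v ≡ true × f v ≡ u))
  functional-cycle G K f f-in f-adj f-no-2-cycle x Kx with iter-periodic f x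
  ... | i , d , period = C , isCycle , λ u v c → case C-edge c of λ
          { (inj₁ e) → inj₁ (orbit-in (C-left c) , e) ; (inj₂ e) → inj₂ (orbit-in (C-right c) , e) }
    where
    in-K : ∀ k → K (iter f k x) ≡ true
    in-K zero    = Kx
    in-K (suc k) = f-in _ (in-K k)
    open FunctionalCycle G K f f-in f-adj f-no-2-cycle (iter f i x) (in-K i) d period

-- Spanning trees

update : ∀ {n} {A : Set} → (Fin n → A) → Fin n → A → Fin n → A
update f v x w with v ≟ᶠ w
... | yes _ = x
... | no  _ = f w

update-same : ∀ {n} {A : Set} (f : Fin n → A) v x → update f v x v ≡ x
update-same f v x with v ≟ᶠ v
... | yes _ = refl
... | no ¬p = ⊥-elim (¬p refl)

update-other : ∀ {n} {A : Set} (f : Fin n → A) {v w} x → v ≢ w → update f v x w ≡ f w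
update-other f {v} {w} x v≢w with v ≟ᶠ w
... | yes p = ⊥-elim (v≢w p)
... | no  _ = refl

-- A subtree of `R` with root `z` and vertex set `K`. The functions are unconstrained outside `K`,
-- and `parent` also at `z`; acyclicity is carried by `parent-level`.
record Tree {n} (R : Fin n → Fin n → Bool) (z : Fin n) : Set where
  field
    K            : VSet n
    parent       : Fin n → Fin n
    level        : Fin n → ℕ
    root-in      : K z ≡ true
    level-root   : level z ≡ 0
    parent-in    : ∀ v → K v ≡ true → v ≢ z → K (parent v) ≡ true
    parent-edge  : ∀ v → K v ≡ true → v ≢ z → R (parent v) v ≡ true
    parent-level : ∀ v → K v ≡ true → v ≢ z → level v ≡ suc (level (parent v))

Closed : ∀ {n} → (Fin n → Fin n → Bool) → VSet n → Set
Closed R K = ∀ u v → K u ≡ true → R u v ≡ true → K v ≡ true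

module _ {n} {R : Fin n → Fin n → Bool} {z : Fin n} where

  open Tree

  extend : (t : Tree R z) → ∀ u v → K t u ≡ true → K t v ≡ false → R u v ≡ true → Tree R z
  extend t u v Ku ¬Kv e = record
    { K            = K′
    ; parent       = parent′
    ; level        = level′
    ; root-in      = trans (old z (v≢ (root-in t))) (root-in t)
    ; level-root   = trans (update-other (level t) _ (v≢ (root-in t))) (level-root t)
    ; parent-in    = λ w → cases w (λ w → K′ (parent′ w) ≡ true)
        (trans (cong K′ parent-v) (trans (old u (v≢ Ku)) Ku))
        (λ Kw w≢z → trans (cong K′ (parent-old Kw))
          (trans (old _ (v≢ (parent-in t w Kw w≢z))) (parent-in t w Kw w≢z)))
    ; parent-edge  = λ w → cases w (λ w → R (parent′ w) w ≡ true)
        (trans (cong (λ p → R p v) parent-v) e)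
        (λ Kw w≢z → trans (cong (λ p → R p w) (parent-old Kw)) (parent-edge t w Kw w≢z))
    ; parent-level = λ w → cases w (λ w → level′ w ≡ suc (level′ (parent′ w)))
        (trans (update-same (level t) v _) (cong suc (≡-sym (trans (cong level′ parent-v) (level-old Ku)))))
        (λ Kw w≢z → trans (level-old Kw) (trans (parent-level t w Kw w≢z)
          (cong suc (≡-sym (trans (cong level′ (parent-old Kw)) (level-old (parent-in t w Kw w≢z)))))))
    }
    where
    K′ : VSet n
    K′ = update (K t) v true
    parent′ : Fin n → Fin n
    parent′ = update (parent t) v u
    level′ : Fin n → ℕ
    level′ = update (level t) v (suc (level t u))
    v≢ : ∀ {w} → K t w ≡ true → v ≢ w
    v≢ Kw refl = true≢false Kw ¬Kv
    old : ∀ w → v ≢ w → K′ w ≡ K t w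
    old w = update-other (K t) true
    parent-v : parent′ v ≡ u
    parent-v = update-same (parent t) v u
    parent-old : ∀ {w} → K t w ≡ true → parent′ w ≡ parent t w
    parent-old Kw = update-other (parent t) u (v≢ Kw)
    level-old : ∀ {w} → K t w ≡ true → level′ w ≡ level t w
    level-old Kw = update-other (level t) _ (v≢ Kw)
    cases : ∀ w (P : Fin n → Set) → P v → (K t w ≡ true → w ≢ z → P w) → K′ w ≡ true → w ≢ z → P w
    cases w P new old-case K′w w≢z with v ≟ᶠ w
    ... | yes refl = new
    ... | no  _    = old-case K′w w≢z

  extend-count : ∀ t u v Ku ¬Kv e → count (K t) < count (K (extend t u v Ku ¬Kv e))
  extend-count t u v Ku ¬Kv e = count-< {P = K t} {update (K t) v true} {v}
    (λ i Ki → trans (update-other (K t) {v} true (λ { refl → true≢false Ki ¬Kv })) Ki)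
    ¬Kv (update-same (K t) v true)

  -- Each extension enlarges `K`, which pays for the fuel spent; at fuel zero the hypothesis would
  -- give `K` more than n vertices.
  grow : ∀ fuel (t : Tree R z) → n < count (K t) + fuel → Σ (Tree R z) (λ t → Closed R (K t))
  grow zero t h = ⊥-elim (<⇒≱ h (≤-trans (≤-reflexive (+-identityʳ _)) (count≤n (K t))))
  grow (suc fuel) t h
    with anyFin? (λ u → anyFin? (λ v → (K t u ≟ᵇ true) ×-dec ((K t v ≟ᵇ false) ×-dec (R u v ≟ᵇ true))))
  ... | yes (u , v , Ku , ¬Kv , e) =
    grow fuel (extend t u v Ku ¬Kv e)
      (≤-trans h (≤-trans (≤-reflexive (+-suc _ fuel)) (+-monoˡ-≤ fuel (extend-count t u v Ku ¬Kv e))))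
  ... | no ¬leaving = t , λ u v Ku e → case bool-cases (K t v) of λ
          { (inj₁ Kv) → Kv ; (inj₂ ¬Kv) → ⊥-elim (¬leaving (u , v , Ku , ¬Kv , e)) }

abstract
  spanning-tree : ∀ {n} (R : Fin n → Fin n → Bool) z → Σ (Tree R z) (λ t → Closed R (Tree.K t))
  spanning-tree {n} R z = grow (suc n) trivial (m≤n+m (suc n) _)
    where
    only-root : ∀ {P : Fin n → Set} v → (z == v) ≡ true → v ≢ z → P v
    only-root v e v≢z = ⊥-elim (v≢z (≡-sym (==⇒≡ e)))
    trivial : Tree R z
    trivial = record
      { K = z ==_ ; parent = id ; level = λ _ → 0 ; root-in = ==-refl z ; level-root = refl
      ; parent-in = only-root ; parent-edge = only-root ; parent-level = only-root }

-- Edge deletion and the orientation of a unicyclic graph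

delete : ∀ {n} → (Fin n → Fin n → Bool) → Fin n → Fin n → Fin n → Fin n → Bool
delete R u v a b = R a b ∧ not (((u == a) ∧ (v == b)) ∨ ((u == b) ∧ (v == a)))

SameEdge : ∀ {n} → Fin n → Fin n → Fin n → Fin n → Set
SameEdge u v a b = (u ≡ a × v ≡ b) ⊎ (u ≡ b × v ≡ a)

sameEdge? : ∀ {n} (u v a b : Fin n) → Dec (SameEdge u v a b)
sameEdge? u v a b = ((u ≟ᶠ a) ×-dec (v ≟ᶠ b)) ⊎-dec ((u ≟ᶠ b) ×-dec (v ≟ᶠ a))

module _ {n} (R : Fin n → Fin n → Bool) (u v : Fin n) where

  delete-⊆ : ∀ {a b} → delete R u v a b ≡ true → R a b ≡ true
  delete-⊆ = ∧-left

  delete-≢ : ∀ {a b} → delete R u v a b ≡ true → ¬ SameEdge u v a b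
  delete-≢ {a} {b} h s = true≢false (same s) (not-true (∧-right {R a b} h))
    where
    same : SameEdge u v a b → ((u == a) ∧ (v == b)) ∨ ((u == b) ∧ (v == a)) ≡ true
    same (inj₁ (refl , refl)) = ∨-introˡ (∧-intro (==-refl u) (==-refl v))
    same (inj₂ (refl , refl)) = ∨-introʳ {(u == a) ∧ (v == b)} (∧-intro (==-refl u) (==-refl v))

  delete-intro : ∀ {a b} → R a b ≡ true → ¬ SameEdge u v a b → delete R u v a b ≡ true
  delete-intro {a} {b} e ¬s = ∧-intro e (false-not (¬true⇒false (λ h → ¬s (unpack (∨-elim {(u == a) ∧ (v == b)} h)))))
    where
    unpack : ((u == a) ∧ (v == b)) ≡ true ⊎ ((u == b) ∧ (v == a)) ≡ true → SameEdge u v a b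
    unpack (inj₁ p) = inj₁ (==⇒≡ (∧-left p) , ==⇒≡ (∧-right {u == a} p))
    unpack (inj₂ p) = inj₂ (==⇒≡ (∧-left p) , ==⇒≡ (∧-right {u == b} p))

  delete-sym : (∀ a b → R a b ≡ true → R b a ≡ true) →
               ∀ a b → delete R u v a b ≡ true → delete R u v b a ≡ true
  delete-sym R-sym a b h = delete-intro (R-sym a b (delete-⊆ h)) (delete-≢ h ∘ [ inj₂ , inj₁ ]′)

adj-≢ : ∀ {n} (G : Graph n) {u v} → adj G u v ≡ true → u ≢ v
adj-≢ G {u} e refl = true≢false e (irrefl G u)

adj-sym : ∀ {n} (G : Graph n) u v → adj G u v ≡ true → adj G v u ≡ true
adj-sym G u v e = trans (Graph.sym G v u) e

-- The edge uv closes the tree path from `v` up to the root `u`. This serves both to exhibit a cycle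
-- in a subgraph and to orient `G` itself.
module Rooted {n} (R : Fin n → Fin n → Bool) {u v : Fin n} (u≢v : u ≢ v) (t : Tree (delete R u v) u)
              (Kv : Tree.K t v ≡ true) where

  open Tree t

  next : Fin n → Fin n
  next = update parent u v

  next-root : next u ≡ v
  next-root = update-same parent u v

  next-parent : ∀ {w} → w ≢ u → next w ≡ parent w
  next-parent w≢u = update-other parent v (w≢u ∘ ≡-sym)

  next-in : ∀ w → K w ≡ true → K (next w) ≡ true
  next-in w Kw with w ≟ᶠ u
  ... | yes refl = trans (cong K next-root) Kv
  ... | no w≢u   = trans (cong K (next-parent w≢u)) (parent-in w Kw w≢u)

  next-edge : R u v ≡ true → (∀ a b → R a b ≡ true → R b a ≡ true) → ∀ w → K w ≡ true → R w (next w) ≡ true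
  next-edge e R-sym w Kw with w ≟ᶠ u
  ... | yes refl = trans (cong (R w) next-root) e
  ... | no w≢u   = trans (cong (R w) (next-parent w≢u)) (R-sym _ _ (delete-⊆ R u v (parent-edge w Kw w≢u)))

  parent-v≢u : parent v ≢ u
  parent-v≢u e = delete-≢ R u v (parent-edge v Kv (u≢v ∘ ≡-sym)) (inj₁ (≡-sym e , refl))

  -- Away from the root two steps lower the level by two. A 2-cycle through the root would make `u`
  -- the parent of `v`, but the tree avoids the edge uv.
  next-no-2-cycle : ∀ w → K w ≡ true → next (next w) ≢ w
  next-no-2-cycle w Kw e with w ≟ᶠ u
  ... | yes refl = parent-v≢u (trans (≡-sym (trans (cong next next-root) (next-parent (u≢v ∘ ≡-sym)))) e)
  ... | no w≢u with parent w ≟ᶠ u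
  ...   | yes p≡u = parent-v≢u (trans (cong parent v≡w) p≡u)
    where
    v≡w : v ≡ w
    v≡w = trans (≡-sym (trans (cong next (trans (next-parent w≢u) p≡u)) next-root)) e
  ...   | no p≢u = m≢1+n+m (level w) {1} (begin
    level w                          ≡⟨ parent-level w Kw w≢u ⟩
    suc (level (parent w))           ≡⟨ cong suc (parent-level _ (parent-in w Kw w≢u) p≢u) ⟩
    2 + level (parent (parent w))    ≡⟨ cong (λ x → 2 + level x) back ⟩
    2 + level w                      ∎)
    where
    open ≡-Reasoning
    back : parent (parent w) ≡ w
    back = trans (≡-sym (trans (cong next (next-parent w≢u)) (next-parent p≢u))) e

TreeEdge : ∀ {n} {R : Fin n → Fin n → Bool} {z} → Tree R z → Fin n → Fin n → Set
TreeEdge {z = z} t u v = u ≢ z × Tree.parent t u ≡ v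

treeEdge? : ∀ {n} {R : Fin n → Fin n → Bool} {z} (t : Tree R z) u v → Dec (TreeEdge t u v)
treeEdge? {z = z} t u v = ¬? (u ≟ᶠ z) ×-dec (Tree.parent t u ≟ᶠ v)

-- R - uv still has a tree containing v, now grown from u; sending its root u to v gives a functional graph.
abstract
  nontree-edge⇒cycle : ∀ {n} (G : Graph n) (R : Fin n → Fin n → Bool) {z} (t : Tree R z) →
    (∀ a b → R a b ≡ true → adj G a b ≡ true) → (∀ a b → R a b ≡ true → R b a ≡ true) →
    ∀ {u v} → Tree.K t u ≡ true → Tree.K t v ≡ true → R u v ≡ true →
    ¬ TreeEdge t u v → ¬ TreeEdge t v u →
    ∃ λ C → IsCycleIn G C × (∀ a b → C a b ≡ true → R a b ≡ true)
  nontree-edge⇒cycle {n} G R {z} t R⊆G R-sym {u} {v} Ku Kv e ¬uv ¬vu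
    with spanning-tree (delete R u v) u
  ... | t′ , closed = proj₁ cycle , proj₁ (proj₂ cycle) , λ a b c → case proj₂ (proj₂ cycle) a b c of λ
          { (inj₁ (K′a , refl)) → next-edge e R-sym a K′a
          ; (inj₂ (K′b , refl)) → R-sym _ _ (next-edge e R-sym b K′b) }
    where
    open Tree t
    open Tree t′ using () renaming (K to K′; root-in to root-in′)
    -- The old tree does not use uv and survives the deletion: from `u` one climbs to `z` and then
    -- descends to any vertex of `K`, in particular to `v`.
    parent-edge′ : ∀ w → K w ≡ true → w ≢ z → delete R u v (parent w) w ≡ true
    parent-edge′ w Kw w≢z = delete-intro R u v (parent-edge w Kw w≢z) λ
      { (inj₁ (refl , refl)) → ¬vu (w≢z , refl)
      ; (inj₂ (refl , refl)) → ¬uv (w≢z , refl) }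
    up : ∀ k w → level w ≡ k → K w ≡ true → K′ w ≡ true → K′ z ≡ true
    up k w lw Kw K′w with w ≟ᶠ z
    ... | yes refl = K′w
    up zero    w lw Kw K′w | no w≢z with trans (≡-sym lw) (parent-level w Kw w≢z)
    ... | ()
    up (suc k) w lw Kw K′w | no w≢z =
      up k (parent w) (suc-injective (trans (≡-sym (parent-level w Kw w≢z)) lw)) (parent-in w Kw w≢z)
        (closed w (parent w) K′w (delete-sym R u v R-sym _ _ (parent-edge′ w Kw w≢z)))
    down : ∀ k w → level w ≡ k → K w ≡ true → K′ w ≡ true
    down k w lw Kw with w ≟ᶠ z
    ... | yes refl = up (level u) u refl Ku root-in′
    down zero    w lw Kw | no w≢z with trans (≡-sym lw) (parent-level w Kw w≢z)
    ... | ()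
    down (suc k) w lw Kw | no w≢z =
      closed (parent w) w
        (down k (parent w) (suc-injective (trans (≡-sym (parent-level w Kw w≢z)) lw)) (parent-in w Kw w≢z))
        (parent-edge′ w Kw w≢z)
    open Rooted R (adj-≢ G (R⊆G u v e)) t′ (down (level v) v refl Kv)
    cycle : ∃ λ C → IsCycleIn G C ×
                    (∀ a b → C a b ≡ true → (K′ a ≡ true × next a ≡ b) ⊎ (K′ b ≡ true × next b ≡ a))
    cycle = functional-cycle G K′ next next-in (λ w K′w → R⊆G _ _ (next-edge e R-sym w K′w)) next-no-2-cycle u root-in′

-- Every edge joins a vertex to its successor; removing the edge from z to its successor leaves a tree rooted at z.
record Orientation {n} (G : Graph n) : Set where
  field
    z          : Fin n
    next       : Fin n → Fin n
    level      : Fin n → ℕ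
    level-z    : level z ≡ 0
    level-next : ∀ v → v ≢ z → level v ≡ suc (level (next v))
    next-adj   : ∀ v → adj G v (next v) ≡ true
    adj-next   : ∀ {u v} → adj G u v ≡ true → next u ≡ v ⊎ next v ≡ u
    no-2-cycle : ∀ v → next (next v) ≢ v

abstract
  orientation : ∀ {n} (G : Graph n) → Unicyclic G → Orientation G
  orientation {n} G uni with Unicyclic.hasCycle uni
  ... | C , isC with IsCycleIn.nonempty isC
  ...   | z , Cz=2 with count≥1⇒∃ {P = C z} (subst (1 ≤_) (≡-sym Cz=2) (s≤s z≤n))
  ...     | y , Czy with spanning-tree (delete (adj G) z y) z
  ...       | t , closed = record
    { z          = z
    ; next       = next
    ; level      = level
    ; level-z    = level-root
    ; level-next = λ v v≢z → trans (parent-level v (all-in v) v≢z) (cong (suc ∘ level) (≡-sym (next-parent v≢z)))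
    ; next-adj   = λ v → next-edge zy (adj-sym G) v (all-in v)
    ; adj-next   = λ {u} {v} → oriented u v
    ; no-2-cycle = λ v → next-no-2-cycle v (all-in v)
    }
    where
    open Tree t
    open IsCycleIn isC
    zy : adj G z y ≡ true
    zy = sub z y Czy
    tree-edges : ∀ u v → K u ≡ true → delete (adj G) z y u v ≡ true → TreeEdge t u v ⊎ TreeEdge t v u
    tree-edges u v Ku e with treeEdge? t u v | treeEdge? t v u
    ... | yes p | _     = inj₁ p
    ... | no _  | yes q = inj₂ q
    -- The cycle found avoids zy, yet by uniqueness it has the same edges as `C`, which contains zy.
    ... | no ¬p | no ¬q with nontree-edge⇒cycle G (delete (adj G) z y) t
                            (λ a b → delete-⊆ (adj G) z y) (delete-sym (adj G) z y (adj-sym G))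
                               Ku (closed u v Ku e) e ¬p ¬q
    ...   | C′ , isC′ , C′⊆R = ⊥-elim (delete-≢ (adj G) z y
              (C′⊆R z y (trans (≡-sym (Unicyclic.unique uni C C′ isC isC′ z y)) Czy)) (inj₁ (refl , refl)))
    -- If y were missing, one could climb the tree along C forever.
    module _ (¬Ky : K y ≡ false) where
      climb-to : ∀ v a → K v ≡ true → C v a ≡ true → delete (adj G) z y v a ≡ true → ¬ TreeEdge t v a →
                 ∃ λ w → K w ≡ true × count (C w) ≡ 2 × level w ≡ suc (level v)
      climb-to v a Kv Cva Rva ¬va with tree-edges v a Kv Rva
      ... | inj₁ va = ⊥-elim (¬va va)
      ... | inj₂ (a≢z , refl) = a , closed v a Kv Rva , a=2 , parent-level a (closed v a Kv Rva) a≢z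
        where
        a=2 : count (C a) ≡ 2
        a=2 with deg02 a
        ... | inj₂ q = q
        ... | inj₁ q = contradiction (subst (1 ≤_) q (count≥1 {P = C a} {v} (trans (csym a v) Cva))) λ ()
      -- Of the two `C`-neighbours of `v` one is not the parent of `v` (for `v = z`: not `y`). The
      -- edge to it is a tree edge, so it is a child of `v`.
      climb : ∀ v → K v ≡ true → count (C v) ≡ 2 →
              ∃ λ w → K w ≡ true × count (C w) ≡ 2 × level w ≡ suc (level v)
      climb v Kv v=2 with v ≟ᶠ z
      climb v Kv v=2 | yes refl with count≥2⇒∃≢ {P = C v} (≤-reflexive (≡-sym v=2)) y
      ... | a , Cva , y≢a = climb-to v a Kv Cva
              (delete-intro (adj G) z y (sub v a Cva)
                (λ { (inj₁ (_ , y≡a)) → y≢a y≡a ; (inj₂ (refl , refl)) → adj-≢ G zy refl }))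
              (λ { (v≢z , _) → v≢z refl })
      climb v Kv v=2 | no v≢z with count≥2⇒∃≢ {P = C v} (≤-reflexive (≡-sym v=2)) (parent v)
      ... | a , Cva , p≢a = climb-to v a Kv Cva
              (delete-intro (adj G) z y (sub v a Cva)
                (λ { (inj₁ (z≡v , _)) → v≢z (≡-sym z≡v) ; (inj₂ (_ , refl)) → true≢false Kv ¬Ky }))
              (λ { (_ , p≡a) → p≢a p≡a })
      climbs : ∀ k → ∃ λ w → K w ≡ true × count (C w) ≡ 2 × level w ≡ k
      climbs zero = z , root-in , Cz=2 , level-root
      climbs (suc k) with climbs k
      ... | v , Kv , v=2 , refl = climb v Kv v=2
      climb-absurd : ⊥
      climb-absurd with climbs (suc (max level))
      ... | w , _ , _ , e = <-irrefl refl (subst (_≤ max level) e (f≤max level w))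
    Ky : K y ≡ true
    Ky with bool-cases (K y)
    ... | inj₁ p = p
    ... | inj₂ q = ⊥-elim (climb-absurd q)
    all-in : ∀ v → K v ≡ true
    all-in v = walk-invariant {P = λ w → K w ≡ true} step root-in
      (reachK⇒walk {R = adj G} n (Unicyclic.connected uni z v))
      where
      step : ∀ a b → K a ≡ true → adj G a b ≡ true → true ≡ true → K b ≡ true
      step a b Ka e _ with sameEdge? z y a b
      ... | yes (inj₁ (_ , refl)) = Ky
      ... | yes (inj₂ (refl , _)) = root-in
      ... | no ¬s = closed a b Ka (delete-intro (adj G) z y e ¬s)
    open Rooted (adj G) (adj-≢ G zy) t Ky
    oriented : ∀ u v → adj G u v ≡ true → next u ≡ v ⊎ next v ≡ u
    oriented u v e with sameEdge? z y u v
    ... | yes (inj₁ (refl , refl)) = inj₁ next-root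
    ... | yes (inj₂ (refl , refl)) = inj₂ next-root
    ... | no ¬s with tree-edges u v (all-in u) (delete-intro (adj G) z y e ¬s)
    ...   | inj₁ (u≢z , p) = inj₁ (trans (next-parent u≢z) p)
    ...   | inj₂ (v≢z , p) = inj₂ (trans (next-parent v≢z) p)

-- Independent sets

evenᵇ : ℕ → Bool
evenᵇ zero    = true
evenᵇ (suc k) = not (evenᵇ k)

module _ {n} (G : Graph n) (O : Orientation G) where

  open Orientation O

  Independent : VSet n → Set
  Independent I = ∀ u v → I u ≡ true → I v ≡ true → adj G u v ≡ false

  evenLevel : VSet n
  evenLevel v = evenᵇ (level v)

  -- The levels colour G properly except for the edge from z to its successor.
  avoiding-z⇒independent : ∀ (I : VSet n) b → I z ≡ false → (∀ v → I v ≡ true → evenLevel v ≡ b) →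
                           Independent I
  avoiding-z⇒independent I b ¬Iz mono u v Iu Iv = ¬true⇒false (λ e →
    case adj-next e of λ { (inj₁ p) → clash u v Iu Iv p ; (inj₂ p) → clash v u Iv Iu p })
    where
    not-fixed : ∀ {b} → not b ≢ b
    not-fixed {true}  ()
    not-fixed {false} ()
    clash : ∀ u v → I u ≡ true → I v ≡ true → next u ≢ v
    clash u v Iu Iv refl = not-fixed (trans (cong not (≡-sym (mono v Iv)))
      (trans (cong evenᵇ (≡-sym (level-next u (λ { refl → true≢false Iu ¬Iz })))) (mono u Iu)))

  -- Only the edge from `z` to its successor can join equal parities. Without `z` the even class is
  -- independent too, and the larger class has at least half of the remaining n - 1 vertices.
  large-independent : ∃ λ I → Independent I × n ≤ suc (count I + count I)
  large-independent = choose (≤-total (count I₀) (count I₁))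
    where
    I₀ I₁ : VSet n
    I₀ = evenLevel ∖ z
    I₁ = outside evenLevel
    z-even : evenLevel z ≡ true
    z-even = cong evenᵇ level-z
    size : n ≡ suc (count I₀ + count I₁)
    size = trans (≡-sym (count-outside evenLevel)) (cong (_+ count I₁) (count-remove evenLevel z z-even))
    independent₀ : Independent I₀
    independent₀ = avoiding-z⇒independent I₀ true
      (¬true⇒false (λ h → proj₂ (∖-elim {P = evenLevel} h) refl))
      (λ v h → proj₁ (∖-elim {P = evenLevel} h))
    independent₁ : Independent I₁
    independent₁ = avoiding-z⇒independent I₁ false (cong not z-even) (λ v h → not-true h)
    choose : count I₀ ≤ count I₁ ⊎ count I₁ ≤ count I₀ → ∃ λ I → Independent I × n ≤ suc (count I + count I)
    choose (inj₁ le) = I₁ , independent₁ , ≤-trans (≤-reflexive size) (s≤s (+-monoˡ-≤ (count I₁) le))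
    choose (inj₂ le) = I₀ , independent₀ , ≤-trans (≤-reflexive size) (s≤s (+-monoʳ-≤ (count I₀) le))

  abstract
    independent-cut : ∃ λ X → τ G X ≤ 1 × count X + ω G X ≡ n × n ≤ suc (ω G X + ω G X)
    independent-cut with large-independent
    ... | I , indep , size = X , τ≤1 , X+ω≡n , subst (λ k → n ≤ suc (k + k)) I≡ω size
      where
      X : VSet n
      X = outside I
      open Components G X
      A⇒I : ∀ {v} → A v ≡ true → I v ≡ true
      A⇒I {v} h = trans (≡-sym (not-involutive (I v))) h
      trivial : ∀ {u v} → Walk (adj G) A u v → u ≡ v
      trivial (nil _)      = refl
      trivial (snoc p e a) = ⊥-elim (true≢false e (indep _ _ (A⇒I (walk-end p)) (A⇒I a)))
      τ≤1 : τ G X ≤ 1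
      τ≤1 = τ≤ (λ v → ≡⇒count≤1 {P = connects v} (λ p q →
        trans (≡-sym (trivial (to-walk p))) (trivial (to-walk q))))
      X+ω≡n : count X + ω G X ≡ n
      X+ω≡n = ≤-antisym |X|+ω≤n (τ≤1⇒n≤|X|+ω τ≤1)
      I≡ω : count I ≡ ω G X
      I≡ω = +-cancelˡ-≡ (count X) _ _
        (trans (+-comm (count X) (count I)) (trans (count-outside I) (≡-sym X+ω≡n)))

-- Greedy cuts

count-disjoint : ∀ {n} {P Q R : VSet n} → (∀ i → Q i ≡ true → P i ≡ true) → (∀ i → R i ≡ true → P i ≡ true) →
                 (∀ i → Q i ≡ true → R i ≡ true → ⊥) → count Q + count R ≤ count P
count-disjoint {P = P} {Q} {R} Q⊆P R⊆P disj = begin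
  count Q + count R                                            ≤⟨ +-mono-≤ q r ⟩
  count (λ i → P i ∧ Q i) + count (λ i → P i ∧ not (Q i))      ≡⟨ count-split P Q ⟨
  count P                                                      ∎
  where
  open ≤-Reasoning
  q : count Q ≤ count (λ i → P i ∧ Q i)
  q = count-mono {P = Q} {λ i → P i ∧ Q i} (λ i h → ∧-intro (Q⊆P i h) h)
  r : count R ≤ count (λ i → P i ∧ not (Q i))
  r = count-mono {P = R} {λ i → P i ∧ not (Q i)}
    (λ i h → ∧-intro (R⊆P i h) (false-not (¬true⇒false (λ Qi → disj i Qi h))))

insert : ∀ {n} → VSet n → Fin n → VSet n
insert X v w = (v == w) ∨ X w

insert-new : ∀ {n} (X : VSet n) v → insert X v v ≡ true
insert-new X v = ∨-introˡ (==-refl v)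

outside-insert : ∀ {n} {X : VSet n} {v w} → outside (insert X v) w ≡ true → outside X w ≡ true × v ≢ w
outside-insert {X = X} {v} {w} h with v ≟ᶠ w
outside-insert {X = X} {v} {w} () | yes _
... | no v≢w = h , v≢w

count-insert : ∀ {n} (X : VSet n) v → X v ≡ false → count (insert X v) ≡ suc (count X)
count-insert X v ¬Xv = trans (count-remove (insert X v) v (insert-new X v)) (cong suc (count-cong pointwise))
  where
  pointwise : ∀ i → (insert X v ∖ v) i ≡ X i
  pointwise i with v ≟ᶠ i
  ... | yes refl = ≡-sym ¬Xv
  ... | no _     = ∧-identityʳ (X i)

module Greedy {n} (G : Graph n) (O : Orientation G) where

  open Orientation O

  -- A vertex `w` stands for the edge from `w` to `next w`. Every edge is represented exactly once,
  -- so `edges X` is the number of edges of G - X.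
  inner : VSet n → VSet n
  inner X w = outside X w ∧ outside X (next w)

  edges : VSet n → ℕ
  edges X = count (inner X)

  nbrs : VSet n → Fin n → VSet n
  nbrs X v w = adj G v w ∧ outside X w

  deg : VSet n → Fin n → ℕ
  deg X v = count (nbrs X v)

  next-≢ : ∀ v → next v ≢ v
  next-≢ v e = adj-≢ G (next-adj v) (≡-sym e)

  -- Neighbours of `v` index the lost edges by their other end, `inner` indexes them by their tail.
  -- These agree for edges entering `v`; the one edge leaving `v` has to be moved from `next v` to
  -- `v`, which is the passage from `out` to `out′`.
  edges-insert : ∀ X v → outside X v ≡ true → edges (insert X v) + deg X v ≤ edges X
  edges-insert X v Av = begin
    edges (insert X v) + deg X v                       ≤⟨ +-mono-≤ kept lost ⟩
    count (λ w → inner X w ∧ inner (insert X v) w) + count F  ≡⟨ count-split (inner X) (inner (insert X v)) ⟨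
    edges X                                            ∎
    where
    open ≤-Reasoning
    F out out′ into : VSet n
    F w    = inner X w ∧ not (inner (insert X v) w)
    out w  = (next v == w) ∧ outside X w
    out′ w = (v == w) ∧ outside X (next w)
    into w = (next w == v) ∧ outside X w
    kept : edges (insert X v) ≤ count (λ w → inner X w ∧ inner (insert X v) w)
    kept = count-mono {P = inner (insert X v)} {λ w → inner X w ∧ inner (insert X v) w} (λ w h →
      ∧-intro (∧-intro (proj₁ (outside-insert {X = X} {v} (∧-left h)))
        (proj₁ (outside-insert {X = X} {v} {next w} (∧-right {outside (insert X v) w} h)))) h)
    split : deg X v ≤ count out + count into
    split = count-∪-≤ {P = nbrs X v} (λ w h → case adj-next {v} {w} (∧-left h) of λ
      { (inj₁ refl) → inj₁ (∧-intro (==-refl w) (∧-right {adj G v w} h))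
      ; (inj₂ refl) → inj₂ (∧-intro (==-refl (next w)) (∧-right {adj G v w} h)) })
    out≤ : count out ≤ count out′
    out≤ = count-injection out out′ (λ _ _ → v)
      (λ w h → ∧-intro (==-refl v) (trans (cong (outside X) (==⇒≡ (∧-left h))) (∧-right {next v == w} h)))
      (λ w w′ h h′ _ → trans (≡-sym (==⇒≡ (∧-left {next v == w} h))) (==⇒≡ (∧-left {next v == w′} h′)))
    out⊆F : ∀ w → out′ w ≡ true → F w ≡ true
    out⊆F w h with ==⇒≡ (∧-left {v == w} h)
    ... | refl = ∧-intro (∧-intro Av (∧-right {v == v} h))
           (false-not (¬true⇒false (λ i → proj₂ (outside-insert {X = X} {v} (∧-left i)) refl)))
    into⊆F : ∀ w → into w ≡ true → F w ≡ true
    into⊆F w h with ==⇒≡ (∧-left {next w == v} h)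
    ... | refl = ∧-intro (∧-intro (∧-right {v == v} h) Av)
           (false-not (¬true⇒false (λ i → proj₂
             (outside-insert {X = X} {v} {v} (∧-right {outside (insert X v) w} i)) refl)))
    lost : deg X v ≤ count F
    lost = ≤-trans split (≤-trans (+-monoˡ-≤ _ out≤) (count-disjoint {P = F} {out′} {into} out⊆F into⊆F
      (λ w h h′ → next-≢ w (trans (==⇒≡ (∧-left h′)) (==⇒≡ (∧-left h))))))

  -- With e(G - X) = n - t, the quantity c bounds t - 2|X| from below, t counting the edges meeting X.
  Surplus : ℕ → VSet n → Set
  Surplus c X = edges X + 2 * count X + c ≤ n

  surplus-empty : Surplus 0 (λ _ → false)
  surplus-empty = begin
    edges (λ _ → false) + 2 * count {n} (λ _ → false) + 0  ≡⟨ +-identityʳ _ ⟩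
    edges (λ _ → false) + 2 * count {n} (λ _ → false)
      ≡⟨ cong (λ k → edges (λ _ → false) + 2 * k) (count-empty {n} (λ _ → refl)) ⟩
    edges (λ _ → false) + 0                                ≡⟨ +-identityʳ _ ⟩
    edges (λ _ → false)                                    ≤⟨ count≤n (inner (λ _ → false)) ⟩
    n ∎
    where open ≤-Reasoning

  -- Deleting `v` destroys at least `2 + d` edges, while `2 * count X` grows by only 2.
  surplus-insert : ∀ {c X} d v → outside X v ≡ true → 2 + d ≤ deg X v → Surplus c X → Surplus (d + c) (insert X v)
  surplus-insert {c} {X} d v Av h s = begin
    edges X′ + 2 * count X′ + (d + c)
      ≡⟨ cong (λ k → edges X′ + 2 * k + (d + c)) (count-insert X v (not-true Av)) ⟩
    edges X′ + 2 * suc (count X) + (d + c)   ≡⟨ rearrange (edges X′) (count X) d c ⟩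
    edges X′ + (2 + d) + (2 * count X + c)   ≤⟨ +-monoˡ-≤ _ (≤-trans (+-monoʳ-≤ (edges X′) h) (edges-insert X v Av)) ⟩
    edges X + (2 * count X + c)              ≡⟨ +-assoc (edges X) _ c ⟨
    edges X + 2 * count X + c                ≤⟨ s ⟩
    n ∎
    where
    open ≤-Reasoning
    X′ : VSet n
    X′ = insert X v
    open +-*-Solver
    rearrange : ∀ e x d c → e + 2 * suc x + (d + c) ≡ e + (2 + d) + (2 * x + c)
    rearrange = solve 4 (λ e x d c → e :+ con 2 :* (con 1 :+ x) :+ (d :+ c)
                                  := e :+ (con 2 :+ d) :+ (con 2 :* x :+ c)) refl

  Matching : VSet n → Set
  Matching X = ∀ v → outside X v ≡ true → deg X v ≤ 1

  -- Each step uses `d = 0` and preserves the surplus. `count X ≤ count Y` is recorded because a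
  -- nonempty start is what later guarantees at least two components.
  greedy : ∀ fuel {c} X → n < count X + fuel → Surplus c X →
           ∃ λ Y → count X ≤ count Y × Surplus c Y × Matching Y
  greedy zero X h s = ⊥-elim (<⇒≱ h (≤-trans (≤-reflexive (+-identityʳ _)) (count≤n X)))
  greedy (suc fuel) X h s with anyFin? (λ v → (outside X v ≟ᵇ true) ×-dec (2 ≤? deg X v))
  ... | no ¬e = X , ≤-refl , s , λ v Av → ≤-pred (≰⇒> (λ d → ¬e (v , Av , d)))
  ... | yes (v , Av , d) with greedy fuel (insert X v)
              (subst (λ k → n < k + fuel) (≡-sym (count-insert X v (not-true Av))) (subst (n <_) (+-suc _ fuel) h))
              (surplus-insert 0 v Av d s)
  ...   | Y , le , rest = Y ,
      ≤-trans (≤-trans (n≤1+n _) (≤-reflexive (≡-sym (count-insert X v (not-true Av))))) le , rest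

  module _ {X : VSet n} (matching : Matching X) where

    open Components G X

    unique-nbr : ∀ {v a b} → A v ≡ true → adj G v a ≡ true → A a ≡ true → adj G v b ≡ true → A b ≡ true → a ≡ b
    unique-nbr {v} Av e a e′ b = count≤1⇒≡ {P = nbrs X v} (matching v Av) (∧-intro e a) (∧-intro e′ b)

    -- A second step, out of `w`, can only lead back to `u`, the one neighbour that `w` has left.
    walk-short : ∀ {u v} → Walk (adj G) A u v → u ≡ v ⊎ adj G u v ≡ true
    walk-short (nil _) = inj₁ refl
    walk-short (snoc {w} {v} p e Av) with walk-short p
    ... | inj₁ refl = inj₂ e
    ... | inj₂ uw   = inj₁ (unique-nbr (walk-end p) (adj-sym G _ _ uw) (walk-start p) e Av)

    matching-τ≤2 : τ G X ≤ 2
    matching-τ≤2 = τ≤ bound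
      where
      bound : ∀ v → count (connects v) ≤ 2
      bound v with bool-cases (A v)
      ... | inj₂ ¬Av = subst (_≤ 2) (≡-sym (count-empty {P = connects v} (λ w →
                         ¬true⇒false (λ c → true≢false (walk-start (to-walk c)) ¬Av)))) z≤n
      ... | inj₁ Av = ≤-trans (count-∪-≤ {P = connects v} {v ==_} {nbrs X v} (λ w c → case walk-short (to-walk c) of λ
                         { (inj₁ refl) → inj₁ (==-refl v) ; (inj₂ e) → inj₂ (∧-intro e (walk-end (to-walk c))) }))
                       (+-mono-≤ (≤-reflexive (count-singleton v)) (matching v Av))

    -- Under `matching` these are the larger ends of the edges of G - X.
    upper : VSet n
    upper v = A v ∧ not (least v)

    upper-nbr : ∀ {v} → upper v ≡ true → ∃ λ u → toℕ u < toℕ v × adj G u v ≡ true × A u ≡ true × A v ≡ true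
    upper-nbr {v} h with least-or-below {v} (∧-left h)
    ... | inj₁ l = ⊥-elim (true≢false l (not-true (∧-right {A v} h)))
    ... | inj₂ (u , u<v , c) with walk-short (to-walk c)
    ...   | inj₁ refl = ⊥-elim (<-irrefl refl u<v)
    ...   | inj₂ e    = u , u<v , e , walk-start (to-walk c) , ∧-left h

    n≤|X|+ω+upper : n ≤ count X + (ω G X + count upper)
    n≤|X|+ω+upper = begin
      n                                                     ≡⟨ count-outside X ⟨
      count X + count A                                     ≡⟨ cong (count X +_) (count-split A least) ⟩
      count X + (count (λ v → A v ∧ least v) + count upper) ≤⟨ +-monoʳ-≤ (count X) (+-monoˡ-≤ _ least≤) ⟩
      count X + (ω G X + count upper) ∎
      where
      open ≤-Reasoning
      least≤ : count (λ v → A v ∧ least v) ≤ ω G X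
      least≤ = count-mono {P = λ v → A v ∧ least v} {least} (λ v → ∧-right {A v})

    upper≤ω : count upper ≤ ω G X
    upper≤ω = count-injection upper least (λ v h → proj₁ (upper-nbr h)) is-least
      (λ v v′ h h′ e → let (u , _ , a , Au , Av) = upper-nbr h ; (u′ , _ , a′ , Au′ , Av′) = upper-nbr h′ in
        unique-nbr Au a Av (subst (λ x → adj G x v′ ≡ true) (≡-sym e) a′) Av′)
      where
      is-least : ∀ v h → least (proj₁ (upper-nbr {v} h)) ≡ true
      is-least v h with upper-nbr {v} h
      ... | u , u<v , e , Au , Av with least-or-below Au
      ...   | inj₁ l = l
      ...   | inj₂ (w , w<u , c) with walk-short (to-walk c)
      ...     | inj₁ refl = ⊥-elim (<-irrefl refl w<u)
      -- A neighbour `w` of `u` below `u` would have to be `v`, which is above `u`.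
      ...     | inj₂ wu with unique-nbr Au (adj-sym G _ _ wu) (walk-start (to-walk c)) e Av
      ...       | refl = ⊥-elim (<-asym u<v w<u)

    upper≤edges : count upper ≤ edges X
    upper≤edges = count-injection upper (inner X) (λ v h → tail v (upper-nbr h))
      (λ v h → tail-inner v (upper-nbr h)) (λ v v′ h h′ → tail-injective v v′ (upper-nbr h) (upper-nbr h′))
      where
      Lower : Fin n → Set
      Lower v = ∃ λ u → toℕ u < toℕ v × adj G u v ≡ true × A u ≡ true × A v ≡ true
      tail : ∀ v → Lower v → Fin n
      tail v (u , _ , e , _) with adj-next e
      ... | inj₁ _ = u
      ... | inj₂ _ = v
      tail-inner : ∀ v l → inner X (tail v l) ≡ true
      tail-inner v (u , _ , e , Au , Av) with adj-next e
      ... | inj₁ refl = ∧-intro Au Av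
      ... | inj₂ refl = ∧-intro Av Au
      tail-injective : ∀ v v′ l l′ → tail v l ≡ tail v′ l′ → v ≡ v′
      tail-injective v v′ (u , u<v , e , _) (u′ , u′<v′ , e′ , _) eq with adj-next e | adj-next e′
      ... | inj₁ p | inj₁ p′ = trans (≡-sym p) (trans (cong next eq) p′)
      ... | inj₂ p | inj₂ p′ = eq
      -- Equal tails make the two edges one edge with its ends exchanged, although both list the
      -- smaller end first.
      ... | inj₁ refl | inj₂ refl = ⊥-elim (<-asym (subst (λ x → toℕ x < toℕ v) eq u<v)
          (subst (λ x → toℕ x < toℕ v′) (cong next (≡-sym eq)) u′<v′))
      ... | inj₂ refl | inj₁ refl = ⊥-elim (<-asym (subst (λ x → toℕ x < toℕ v) (cong next eq) u<v)
          (subst (λ x → toℕ x < toℕ v′) (≡-sym eq) u′<v′))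

    -- A graph with p vertices and e edges has at least p - e components. Here p = n - |X|, and the
    -- surplus gives e ≤ n - 2|X| - c.
    matching-ω≥ : ∀ {c} → Surplus c X → count X + c ≤ ω G X
    matching-ω≥ {c} s = +-cancelˡ-≤ (edges X + count X) _ _ (begin
      edges X + count X + (count X + c)   ≡⟨ rearrange (edges X) (count X) c ⟩
      edges X + 2 * count X + c           ≤⟨ s ⟩
      n                                   ≤⟨ n≤|X|+ω+upper ⟩
      count X + (ω G X + count upper)     ≤⟨ +-monoʳ-≤ (count X) (+-monoʳ-≤ (ω G X) upper≤edges) ⟩
      count X + (ω G X + edges X)         ≡⟨ rearrange′ (count X) (ω G X) (edges X) ⟩
      edges X + count X + ω G X           ∎)
      where
      open ≤-Reasoning
      open +-*-Solver
      rearrange : ∀ e x c → e + x + (x + c) ≡ e + 2 * x + c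
      rearrange = solve 3 (λ e x c → e :+ x :+ (x :+ c) := e :+ con 2 :* x :+ c) refl
      rearrange′ : ∀ x w e → x + (w + e) ≡ e + x + w
      rearrange′ = solve 3 (λ x w e → x :+ (w :+ e) := e :+ x :+ w) refl

    matching-n≤ : n ≤ count X + (ω G X + ω G X)
    matching-n≤ = ≤-trans n≤|X|+ω+upper (+-monoʳ-≤ (count X) (+-monoʳ-≤ (ω G X) upper≤ω))

  abstract
    surplus-cut : ∀ {c} S → Surplus c S →
      ∃ λ X → count S ≤ count X × τ G X ≤ 2 × count X + c ≤ ω G X × n ≤ count X + (ω G X + ω G X)
    surplus-cut {c} S s with greedy (suc n) S (m≤n+m (suc n) (count S)) s
    ... | X , le , s′ , matching = X , le , matching-τ≤2 matching , matching-ω≥ matching s′ , matching-n≤ matching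

  deg-empty : ∀ v → deg (λ _ → false) v ≡ degree G v
  deg-empty v = count-cong (λ w → ∧-identityʳ (adj G v w))

  deg-nonadjacent : ∀ u v → adj G v u ≡ false → deg (insert (λ _ → false) u) v ≡ degree G v
  deg-nonadjacent u v ¬vu = count-cong pointwise
    where
    pointwise : ∀ w → nbrs (insert (λ _ → false) u) v w ≡ adj G v w
    pointwise w with u ≟ᶠ w
    ... | yes refl rewrite ¬vu = refl
    ... | no _ = ∧-identityʳ (adj G v w)

  surplus-degree : ∀ d v → 2 + d ≤ degree G v → Surplus d (insert (λ _ → false) v)
  surplus-degree d v h = subst (λ c → Surplus c (insert (λ _ → false) v)) (+-identityʳ d)
    (surplus-insert d v refl (subst (2 + d ≤_) (≡-sym (deg-empty v)) h) surplus-empty)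

  -- Nonadjacency means that deleting `u` leaves the degree of `v` unchanged, so each of the two
  -- deletions gains 1.
  surplus-pair : ∀ u v → u ≢ v → adj G v u ≡ false → 3 ≤ degree G u → 3 ≤ degree G v →
                 Surplus 2 (insert (insert (λ _ → false) u) v)
  surplus-pair u v u≢v ¬vu du dv = surplus-insert 1 v
    (cong (λ b → not (b ∨ false)) (≢⇒== u≢v))
    (subst (3 ≤_) (≡-sym (deg-nonadjacent u v ¬vu)) dv) (surplus-degree 1 u du)

-- Upper bounds for ω

module Exits {n} (G : Graph n) (O : Orientation G) (X : VSet n) where

  open Orientation O
  open Components G X

  exit : VSet n
  exit w = A w ∧ X (next w)

  HasExit : Fin n → Set
  HasExit v = ∃ λ w → exit w ≡ true × Walk (adj G) A v w

  step-out : ∀ v → A v ≡ true → exit v ≡ true ⊎ Walk (adj G) A v (next v)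
  step-out v Av with bool-cases (X (next v))
  ... | inj₁ Xn  = inj₁ (∧-intro Av Xn)
  ... | inj₂ ¬Xn = inj₂ (walk-edge Av (next-adj v) (false-not ¬Xn))

  -- Induction on the level, which drops with every step along `next` taken outside `z`.
  exit-or-z : ∀ k v → level v ≡ k → A v ≡ true → HasExit v ⊎ Walk (adj G) A v z
  exit-or-z k v lv Av with v ≟ᶠ z | step-out v Av
  ... | yes refl | _      = inj₂ (nil Av)
  ... | no _     | inj₁ x = inj₁ (v , x , nil Av)
  exit-or-z zero v lv Av | no v≢z | inj₂ p with trans (≡-sym lv) (level-next v v≢z)
  ... | ()
  exit-or-z (suc k) v lv Av | no v≢z | inj₂ p
    with exit-or-z k (next v) (suc-injective (trans (≡-sym (level-next v v≢z)) lv)) (walk-end p)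
  ... | inj₁ (w , x , q) = inj₁ (w , x , walk-++ p q)
  ... | inj₂ q           = inj₂ (walk-++ p q)

  -- A path along `next` that meets no exit arrives at `z`; if `z` in turn reaches an exit, every
  -- component contains one, and exits serve as markers.
  ω≤exits : (∀ v → Walk (adj G) A v z → HasExit z) → ω G X ≤ count exit
  ω≤exits z-exits = ω≤ exit (λ v l → marker v (exit-or-z (level v) v refl (least-outside l)))
    where
    marker : ∀ v → HasExit v ⊎ Walk (adj G) A v z → ∃ λ w → exit w ≡ true × connects v w ≡ true
    marker v (inj₁ (w , x , p)) = w , x , of-walk p
    marker v (inj₂ q) with z-exits v q
    ... | w , x , p = w , x , of-walk (walk-++ q p)

  ω≤1+exits : ω G X ≤ suc (count exit)
  ω≤1+exits = ≤-trans (ω≤ (insert exit z) (λ v l → marker v (exit-or-z (level v) v refl (least-outside l))))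
    (≤-trans (count-∪-≤ {P = insert exit z} {z ==_} {exit} (λ w → ∨-elim {z == w}))
      (≤-reflexive (cong (_+ count exit) (count-singleton z))))
    where
    marker : ∀ v → HasExit v ⊎ Walk (adj G) A v z → ∃ λ w → insert exit z w ≡ true × connects v w ≡ true
    marker v (inj₁ (w , x , p)) = w , ∨-introʳ {z == w} x , of-walk p
    marker v (inj₂ q)           = z , insert-new exit z , of-walk q

  -- At most one component has no exit, and it contains z and the next two vertices of the cycle.
  ω-bound : ω G X ≤ count exit ⊎ (3 ≤ τ G X × ω G X ≤ suc (count exit))
  ω-bound with bool-cases (A z)
  ... | inj₂ ¬Az = inj₁ (ω≤exits (λ v q → ⊥-elim (true≢false (walk-end q) ¬Az)))
  ... | inj₁ Az with step-out z Az
  ...   | inj₁ x = inj₁ (ω≤exits (λ _ _ → z , x , nil Az))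
  ...   | inj₂ p with step-out (next z) (walk-end p)
  ...     | inj₁ x = inj₁ (ω≤exits (λ _ _ → next z , x , p))
  ...     | inj₂ q = inj₂ (≤-trans three (component≤τ z) , ω≤1+exits)
    where
    next-≢ : ∀ v → v ≢ next v
    next-≢ v = adj-≢ G (next-adj v)
    three : 3 ≤ count (connects z)
    three = count≥3 {P = connects z} (of-walk (nil Az)) (of-walk p) (of-walk (walk-++ p q))
      (next-≢ z) (no-2-cycle z ∘ ≡-sym) (next-≢ (next z))

  indegree : Fin n → ℕ
  indegree x = count (λ w → next w == x)

  1+indegree≤degree : ∀ x → suc (indegree x) ≤ degree G x
  1+indegree≤degree x = subst (_≤ degree G x) (cong (_+ indegree x) (count-singleton (next x)))
    (count-disjoint {P = adj G x} {next x ==_} {λ w → next w == x}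
      (λ w h → subst (λ y → adj G x y ≡ true) (==⇒≡ h) (next-adj x))
      (λ w h → adj-sym G w x (subst (λ y → adj G w y ≡ true) (==⇒≡ h) (next-adj w)))
      (λ w h h′ → no-2-cycle x (trans (cong next (==⇒≡ h)) (==⇒≡ h′))))

  entering : VSet n
  entering w = X (next w)

  internal : VSet n
  internal w = X w ∧ X (next w)

  exit+internal≤entering : count exit + count internal ≤ count entering
  exit+internal≤entering = count-disjoint {P = entering} {exit} {internal}
    (λ w h → ∧-right {A w} h) (λ w h → ∧-right {X w} h)
    (λ w h h′ → true≢false (∧-left {X w} h′) (not-true (∧-left h)))

  deg3 : VSet n
  deg3 x = X x ∧ (degree G x ≡ᵇ 3)

  -- Double counting by heads: a vertex of `X` has at most deg - 1 predecessors, hence at most one,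
  -- or two if its degree is 3.
  entering≤ : (∀ v → degree G v ≤ 3) → count entering ≤ count X + count deg3
  entering≤ deg≤3 = begin
    count entering                                ≡⟨ count-sum entering ⟩
    sum (λ w → ind (X (next w)))                  ≡⟨ sum-cong-≗ expand ⟩
    sum (λ w → sum (λ x → ind (Q w x)))           ≡⟨ ∑-comm (λ w x → ind (Q w x)) ⟩
    sum (λ x → sum (λ w → ind (Q w x)))           ≡⟨ sum-cong-≗ (λ x → ≡-sym (count-sum (λ w → Q w x))) ⟩
    sum (λ x → count (λ w → Q w x))               ≤⟨ sum-mono bound ⟩
    sum (λ x → ind (X x) + ind (deg3 x))          ≡⟨ ∑-distrib-+ (ind ∘ X) (ind ∘ deg3) ⟩
    sum (ind ∘ X) + sum (ind ∘ deg3)              ≡⟨ cong₂ _+_ (count-sum X) (count-sum deg3) ⟨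
    count X + count deg3 ∎
    where
    open ≤-Reasoning
    Q : Fin n → Fin n → Bool
    Q w x = X x ∧ (next w == x)
    expand : ∀ w → ind (X (next w)) ≡ sum (λ x → ind (Q w x))
    expand w = trans (≡-sym (trans (count-cong pointwise) (single (X (next w))))) (count-sum (Q w))
      where
      pointwise : ∀ x → Q w x ≡ X (next w) ∧ (next w == x)
      pointwise x with next w ≟ᶠ x
      ... | yes refl = refl
      ... | no _ with X x | X (next w)
      ...   | true  | true  = refl
      ...   | true  | false = refl
      ...   | false | true  = refl
      ...   | false | false = refl
      single : ∀ b → count (λ x → b ∧ (next w == x)) ≡ ind b
      single true  = count-singleton (next w)
      single false = count-empty {n} (λ _ → refl)
    small : ∀ k d → suc k ≤ d → d ≤ 3 → k ≤ suc (ind (d ≡ᵇ 3))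
    small zero          d h l = z≤n
    small (suc zero)    d h l = s≤s z≤n
    small (suc (suc k)) d h l with ≤-antisym l (≤-trans (s≤s (s≤s (s≤s z≤n))) h)
    ... | refl = ≤-pred h
    bound : ∀ x → count (λ w → Q w x) ≤ ind (X x) + ind (deg3 x)
    bound x with X x
    ... | false = ≤-reflexive (count-empty {n} (λ _ → refl))
    ... | true  = small (indegree x) (degree G x) (1+indegree≤degree x) (deg≤3 x)

  -- Arcs inside `X` enter `X` without being exits, so they offset all but `c` of the vertices of
  -- degree 3.
  exits≤ : (∀ v → degree G v ≤ 3) → ∀ {c} → count deg3 ≤ c + count internal → count exit ≤ count X + c
  exits≤ deg≤3 {c} h = +-cancelʳ-≤ (count internal) _ _ (begin
    count exit + count internal         ≤⟨ exit+internal≤entering ⟩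
    count entering                      ≤⟨ entering≤ deg≤3 ⟩
    count X + count deg3                ≤⟨ +-monoʳ-≤ (count X) h ⟩
    count X + (c + count internal)      ≡⟨ +-assoc (count X) c _ ⟨
    count X + c + count internal        ∎)
    where open ≤-Reasoning

  exits≤|X| : (∀ v → degree G v ≤ 2) → count exit ≤ count X + 0
  exits≤|X| deg≤2 = exits≤ (λ v → ≤-trans (deg≤2 v) (n≤1+n 2))
      (subst (_≤ count internal) (≡-sym (count-empty none)) z≤n)
    where
    none : ∀ x → deg3 x ≡ false
    none x = ¬true⇒false (λ h → contradiction
      (subst (_≤ 2) (≡ᵇ⇒≡ (degree G x) 3 (subst T (≡-sym (∧-right {X x} h)) _)) (deg≤2 x)) λ { (s≤s (s≤s ())) })

  -- The other vertices of degree 3 in X are adjacent to u, and distinct ones use distinct edges inside X.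
  exits≤1+|X| : EvenCondition G → count exit ≤ count X + 1
  exits≤1+|X| (deg≤3 , adjacent) = exits≤ deg≤3 few
    where
    deg3-X : ∀ {v} → deg3 v ≡ true → X v ≡ true
    deg3-X = ∧-left
    deg3-3 : ∀ {v} → deg3 v ≡ true → degree G v ≡ 3
    deg3-3 {v} h = ≡ᵇ⇒≡ (degree G v) 3 (subst T (≡-sym (∧-right {X v} h)) _)
    few : count deg3 ≤ 1 + count internal
    few with anyFin? (λ u → deg3 u ≟ᵇ true)
    ... | no none = subst (_≤ 1 + count internal) (≡-sym (count-empty (λ u → ¬true⇒false (λ h → none (u , h))))) z≤n
    ... | yes (u , u3) = subst (_≤ 1 + count internal) (≡-sym (count-remove deg3 u u3))
            (s≤s (count-injection (deg3 ∖ u) internal (λ v h → tail v (edge v h))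
              (λ v h → tail-internal v (edge v h) (proj₁ (∖-elim {P = deg3} h)))
              (λ v v′ h h′ → tail-injective v v′ (edge v h) (edge v′ h′)
                (proj₂ (∖-elim {P = deg3} h)) (proj₂ (∖-elim {P = deg3} h′)))))
      where
      edge : ∀ v → (deg3 ∖ u) v ≡ true → next u ≡ v ⊎ next v ≡ u
      edge v h with ∖-elim {P = deg3} h
      ... | v3 , u≢v = adj-next (adjacent u v u≢v (deg3-3 u3) (deg3-3 v3))
      tail : ∀ v → next u ≡ v ⊎ next v ≡ u → Fin n
      tail v (inj₁ _) = u
      tail v (inj₂ _) = v
      tail-internal : ∀ v e → deg3 v ≡ true → internal (tail v e) ≡ true
      tail-internal v (inj₁ refl) v3 = ∧-intro (deg3-X u3) (deg3-X v3)
      tail-internal v (inj₂ refl) v3 = ∧-intro (deg3-X v3) (deg3-X u3)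
      tail-injective : ∀ v v′ e e′ → u ≢ v → u ≢ v′ → tail v e ≡ tail v′ e′ → v ≡ v′
      tail-injective v v′ (inj₁ p) (inj₁ p′) _   _    _  = trans (≡-sym p) p′
      tail-injective v v′ (inj₁ p) (inj₂ p′) _   u≢v′ eq = ⊥-elim (u≢v′ eq)
      tail-injective v v′ (inj₂ p) (inj₁ p′) u≢v _    eq = ⊥-elim (u≢v (≡-sym eq))
      tail-injective v v′ (inj₂ p) (inj₂ p′) _   _    eq = eq

-- Cycle graphs

≡ᵇ-true⇒≡ : ∀ {m n} → (m ≡ᵇ n) ≡ true → m ≡ n
≡ᵇ-true⇒≡ {m} {n} h = ≡ᵇ⇒≡ m n (subst T (≡-sym h) _)

≡⇒≡ᵇ-true : ∀ {m n} → m ≡ n → (m ≡ᵇ n) ≡ true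
≡⇒≡ᵇ-true {m} {n} e with m ≡ᵇ n | ≡⇒≡ᵇ m n e
... | true | _ = refl

-- A copy of the function local to `cycleAdj`; both unfold to the same expression, so
-- `cycleAdj n i j` is `step i j ∨ step j i` by computation.
step : ∀ {n} → Fin n → Fin n → Bool
step {n} a b = (toℕ b ≡ᵇ suc (toℕ a)) ∨ ((toℕ a ≡ᵇ n ∸ 1) ∧ (toℕ b ≡ᵇ 0))

Step : ∀ {n} → Fin n → Fin n → Set
Step {n} a b = toℕ b ≡ suc (toℕ a) ⊎ (toℕ a ≡ n ∸ 1 × toℕ b ≡ 0)

step-elim : ∀ {n} (a b : Fin n) → step a b ≡ true → Step a b
step-elim {n} a b h with ∨-elim {toℕ b ≡ᵇ suc (toℕ a)} h
... | inj₁ p = inj₁ (≡ᵇ-true⇒≡ p)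
... | inj₂ q = inj₂ (≡ᵇ-true⇒≡ (∧-left q) , ≡ᵇ-true⇒≡ (∧-right {toℕ a ≡ᵇ n ∸ 1} q))

step-intro : ∀ {n} (a b : Fin n) → Step a b → step a b ≡ true
step-intro a b (inj₁ e)        = ∨-introˡ (≡⇒≡ᵇ-true e)
step-intro a b (inj₂ (e , e′)) = ∨-introʳ {toℕ b ≡ᵇ suc (toℕ a)} (∧-intro (≡⇒≡ᵇ-true e) (≡⇒≡ᵇ-true e′))

not-last : ∀ {n} {a b : Fin n} → toℕ b ≡ suc (toℕ a) → toℕ a ≢ n ∸ 1
not-last {suc n} {a} {b} e e′ = <-irrefl (trans e (cong suc e′)) (toℕ<n b)

step-functional : ∀ {n} {a b b′ : Fin n} → Step a b → Step a b′ → b ≡ b′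
step-functional (inj₁ e)       (inj₁ e′)        = toℕ-injective (trans e (≡-sym e′))
step-functional {a = a} {b} (inj₁ e)       (inj₂ (l , _))   = ⊥-elim (not-last {a = a} {b} e l)
step-functional {a = a} {_} {b′} (inj₂ (l , _)) (inj₁ e)   = ⊥-elim (not-last {a = a} {b′} e l)
step-functional (inj₂ (_ , e)) (inj₂ (_ , e′))  = toℕ-injective (trans e (≡-sym e′))

step-injective : ∀ {n} {a a′ b : Fin n} → Step a b → Step a′ b → a ≡ a′
step-injective (inj₁ e)       (inj₁ e′)        = toℕ-injective (suc-injective (trans (≡-sym e) e′))
step-injective (inj₁ e)       (inj₂ (_ , e′))  = contradiction (trans (≡-sym e) e′) λ ()
step-injective (inj₂ (_ , e)) (inj₁ e′)        = contradiction (trans (≡-sym e) e′) λ ()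
step-injective (inj₂ (l , _)) (inj₂ (l′ , _))  = toℕ-injective (trans l (≡-sym l′))

-- The bound on n is sharp: for n = 2 the wraparound gives 0, 1, 0, and for n = 1 a loop. With `a`
-- equal to `b` this also yields irreflexivity.
step-asymmetric : ∀ {n} {a b : Fin n} → 3 ≤ n → Step a b → Step b a → ⊥
step-asymmetric {a = a} h (inj₁ e) (inj₁ e′) = m≢1+n+m (toℕ a) {1} (trans e′ (cong suc e))
step-asymmetric {suc n} (s≤s h) (inj₁ e) (inj₂ (l , e₀)) =
  contradiction (subst (2 ≤_) (trans (≡-sym l) (trans e (cong suc e₀))) h) λ { (s≤s ()) }
step-asymmetric {suc n} (s≤s h) (inj₂ (l , e₀)) (inj₁ e) =
  contradiction (subst (2 ≤_) (trans (≡-sym l) (trans e (cong suc e₀))) h) λ { (s≤s ()) }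
step-asymmetric {suc n} (s≤s h) (inj₂ (l , _)) (inj₂ (_ , e)) =
  contradiction (subst (2 ≤_) (trans (≡-sym l) e) h) λ ()

cycleGraph-degree≤2 : ∀ {n} (G : Graph n) → IsCycleGraph G → ∀ v → degree G v ≤ 2
cycleGraph-degree≤2 {n} G (σ , σ-adj) v =
  ≤-trans (count-∪-≤ {P = adj G v} {ahead} {behind} (λ w e → ∨-elim {ahead w} (trans (≡-sym (along w)) e)))
    (+-mono-≤
      (≡⇒count≤1 {P = ahead} (λ p q → from-injective
        (step-functional (step-elim (from v) _ p) (step-elim (from v) _ q))))
      (≡⇒count≤1 {P = behind} (λ p q → from-injective
        (step-injective (step-elim _ (from v) p) (step-elim _ (from v) q)))))
  where
  open Inverse σ using (to; from; strictlyInverseˡ)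
  ahead behind : VSet n
  ahead w  = step (from v) (from w)
  behind w = step (from w) (from v)
  along : ∀ w → adj G v w ≡ ahead w ∨ behind w
  along w = trans (≡-sym (cong₂ (adj G) (strictlyInverseˡ v) (strictlyInverseˡ w))) (σ-adj (from v) (from w))
  from-injective : ∀ {a b} → from a ≡ from b → a ≡ b
  from-injective {a} {b} e = trans (≡-sym (strictlyInverseˡ a)) (trans (cong to e) (strictlyInverseˡ b))

cycleGraph : ∀ n → 3 ≤ n → Graph n
cycleGraph n 3≤n = record
  { adj    = cycleAdj n
  ; sym    = λ u v → bool-ext (swap u v) (swap v u)
  ; irrefl = λ v → ¬true⇒false (λ h → case ∨-elim {step v v} h of λ
      { (inj₁ p) → loop v p ; (inj₂ p) → loop v p })
  }
  where
  swap : ∀ u v → cycleAdj n u v ≡ true → cycleAdj n v u ≡ true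
  swap u v h with ∨-elim {step u v} h
  ... | inj₁ p = ∨-introʳ {step v u} p
  ... | inj₂ p = ∨-introˡ p
  loop : ∀ v → step v v ≡ true → ⊥
  loop v p = step-asymmetric 3≤n (step-elim v v p) (step-elim v v p)

cycleGraph-isCycleGraph : ∀ n 3≤n → IsCycleGraph (cycleGraph n 3≤n)
cycleGraph-isCycleGraph n 3≤n = mk↔ₛ′ id id (λ _ → refl) (λ _ → refl) , λ i j → refl

successor : ∀ {n} (v : Fin n) → ∃ λ w → Step v w
successor {suc n} v with suc (toℕ v) <? suc n
... | yes h = fromℕ< h , inj₁ (toℕ-fromℕ< h)
... | no h  = zero , inj₂ (≤-antisym (≤-pred (toℕ<n v)) (≤-pred (≮⇒≥ h)) , refl)

cycleGraph-connected : ∀ n 3≤n → Connected (cycleGraph n 3≤n)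
cycleGraph-connected (suc n) 3≤n u v = walk⇒reach {R = adj G}
  (walk-++ (walk-sym (Graph.sym G) (from-zero u)) (from-zero v))
  where
  G : Graph (suc n)
  G = cycleGraph (suc n) 3≤n
  from-zero : ∀ v → Walk (adj G) (λ _ → true) zero v
  from-zero = <-weakInduction (Walk (adj G) (λ _ → true) zero) (nil refl) (λ i p →
    snoc p (∨-introˡ (step-intro (inject₁ i) (suc i) (inj₁ (cong suc (≡-sym (toℕ-inject₁ i)))))) refl)

-- A vertex on `C` has both its possible edges in `C`, so its neighbours lie on `C` as well; by
-- connectedness `C` is all of `G`.
cycle-unique : ∀ {n} (G : Graph n) → Connected G → (∀ v → degree G v ≤ 2) →
               ∀ C → IsCycleIn G C → ∀ u v → C u v ≡ adj G u v
cycle-unique {n} G conn deg≤2 C isC u v = full u (walk-invariant {P = λ w → count (C w) ≡ 2} spread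
    (proj₂ nonempty) (reachK⇒walk {R = adj G} n (conn (proj₁ nonempty) u))) v
  where
  open IsCycleIn isC hiding (conn)
  full : ∀ a → count (C a) ≡ 2 → ∀ b → C a b ≡ adj G a b
  full a a=2 = ⊆-count-≡ {P = C a} {adj G a} (sub a) (≤-trans (deg≤2 a) (≤-reflexive (≡-sym a=2)))
  spread : ∀ a b → count (C a) ≡ 2 → adj G a b ≡ true → true ≡ true → count (C b) ≡ 2
  spread a b a=2 e _ with deg02 b
  ... | inj₂ q = q
  ... | inj₁ q = contradiction
          (subst (1 ≤_) q (count≥1 {P = C b} {a} (trans (csym b a) (trans (full a a=2 b) e)))) λ ()

abstract
  cycleGraph-unicyclic : ∀ n 3≤n → Unicyclic (cycleGraph n 3≤n)
  cycleGraph-unicyclic n 3≤n = record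
    { connected = conn
    ; hasCycle  = cycle
    ; unique    = λ C C′ isC isC′ u v → trans (unique C isC u v) (≡-sym (unique C′ isC′ u v))
    }
    where
    G : Graph n
    G = cycleGraph n 3≤n
    conn : Connected G
    conn = cycleGraph-connected n 3≤n
    unique : ∀ C → IsCycleIn G C → ∀ u v → C u v ≡ adj G u v
    unique = cycle-unique G conn (cycleGraph-degree≤2 G (cycleGraph-isCycleGraph n 3≤n))
    some : ∀ {m} → 3 ≤ m → Fin m
    some (s≤s _) = zero
    next : Fin n → Fin n
    next = proj₁ ∘ successor
    cycle : ∃ λ C → IsCycleIn G C
    cycle with functional-cycle G (λ _ → true) next (λ _ _ → refl)
      (λ v _ → ∨-introˡ (step-intro v (next v) (proj₂ (successor v))))
      (λ v _ e → step-asymmetric 3≤n (proj₂ (successor v)) (subst (Step (next v)) e (proj₂ (successor (next v)))))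
      (some 3≤n) refl
    ... | C , isC , _ = C , isC

abstract
  injective⇒surjective : ∀ {n} (f : Fin n → Fin n) → (∀ {a b} → f a ≡ f b → a ≡ b) → ∀ y → ∃ λ x → f x ≡ y
  injective⇒surjective {n} f inj y
    with any-elim (λ x → f x == y) (⊆-count-≡ {P = image} {λ _ → true} (λ _ _ → refl) large y)
    where
    image : VSet n
    image y = any (λ x → f x == y) (allFin n)
    large : count {n} (λ _ → true) ≤ count image
    large = count-injection (λ _ → true) image (λ x _ → f x)
      (λ x _ → any-intro (λ x′ → f x′ == f x) x (==-refl (f x))) (λ a b _ _ → inj)
  ... | x , h = x , ==⇒≡ h

module _ {n} (G : Graph n) (O : Orientation G) (deg≤2 : ∀ v → degree G v ≤ 2) where

  open Orientation O

  -- Two predecessors of a vertex and its successor would be three neighbours; the successor differs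
  -- from both as there are no 2-cycles.
  next-injective : ∀ {u v} → next u ≡ next v → u ≡ v
  next-injective {u} {v} e with u ≟ᶠ v
  ... | yes p  = p
  ... | no u≢v = contradiction
    (≤-trans (count≥3 {P = adj G (next u)} {u} {v} {next (next u)} (adj-sym G _ _ (next-adj u))
        (subst (λ x → adj G x v ≡ true) (≡-sym e) (adj-sym G _ _ (next-adj v))) (next-adj (next u))
        u≢v (no-2-cycle u ∘ ≡-sym) (λ q → no-2-cycle v (trans (cong next (≡-sym e)) (≡-sym q))))
      (deg≤2 (next u)))
    λ { (s≤s (s≤s ())) }

  level-0⇒z : ∀ {v} → level v ≡ 0 → v ≡ z
  level-0⇒z {v} e with v ≟ᶠ z
  ... | yes p  = p
  ... | no v≢z = contradiction (trans (≡-sym e) (level-next v v≢z)) λ ()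

  level-suc⇒≢z : ∀ {v k} → level v ≡ suc k → v ≢ z
  level-suc⇒≢z e refl = contradiction (trans (≡-sym e) level-z) λ ()

  level-pred : ∀ {v k} → level v ≡ suc k → level (next v) ≡ k
  level-pred {v} e = suc-injective (trans (≡-sym (level-next v (level-suc⇒≢z e))) e)

  level-injective : ∀ k {u v} → level u ≡ k → level v ≡ k → u ≡ v
  level-injective zero    e e′ = trans (level-0⇒z e) (≡-sym (level-0⇒z e′))
  level-injective (suc k) e e′ = next-injective (level-injective k (level-pred e) (level-pred e′))

  level-iter : ∀ i k {v} → level v ≡ i + k → level (iter next i v) ≡ k
  level-iter zero    k e = e
  level-iter (suc i) k e = level-pred (level-iter i (suc k) (trans e (≡-sym (+-suc i k))))

  -- The iterates of `v` down to level 0 have distinct levels, so these `suc (level v)` vertices are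
  -- distinct.
  level<n : ∀ v → level v < n
  level<n v = injective⇒≤ {f = λ (i : Fin (suc (level v))) → iter next (toℕ i) v} (λ {i} {j} e →
    toℕ-injective (∸-cancelˡ-≡ (≤-pred (toℕ<n i)) (≤-pred (toℕ<n j))
      (trans (≡-sym (lev i)) (trans (cong level e) (lev j)))))
    where
    lev : ∀ (i : Fin (suc (level v))) → level (iter next (toℕ i) v) ≡ level v ∸ toℕ i
    lev i = level-iter (toℕ i) (level v ∸ toℕ i) (≡-sym (m+[n∸m]≡n (≤-pred (toℕ<n i))))

  position : Fin n → Fin n
  position v = fromℕ< (level<n v)

  toℕ-position : ∀ v → toℕ (position v) ≡ level v
  toℕ-position v = toℕ-fromℕ< (level<n v)

  position-injective : ∀ {u v} → position u ≡ position v → u ≡ v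
  position-injective {u} {v} e = level-injective (level v)
    (trans (≡-sym (toℕ-position u)) (trans (cong toℕ e) (toℕ-position v))) refl

  vertex : Fin n → Fin n
  vertex i = proj₁ (injective⇒surjective position position-injective i)

  position-vertex : ∀ i → position (vertex i) ≡ i
  position-vertex i = proj₂ (injective⇒surjective position position-injective i)

  level-vertex : ∀ i → level (vertex i) ≡ toℕ i
  level-vertex i = trans (≡-sym (toℕ-position (vertex i))) (cong toℕ (position-vertex i))

  -- The predecessor of a vertex of top level can only be z.
  level-next-z : level (next z) ≡ n ∸ 1
  level-next-z = top (proj₁ pre) (trans (cong level (proj₂ pre)) (trans (level-vertex _) (proj₂ (last z))))
    where
    last : ∀ {m} → Fin m → ∃ λ (i : Fin m) → toℕ i ≡ m ∸ 1
    last {suc m} _ = fromℕ< (n<1+n m) , toℕ-fromℕ< (n<1+n m)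
    pre : ∃ λ w → next w ≡ vertex (proj₁ (last z))
    pre = injective⇒surjective next next-injective (vertex (proj₁ (last z)))
    m≤1+[m∸1] : ∀ m → m ≤ suc (m ∸ 1)
    m≤1+[m∸1] zero    = z≤n
    m≤1+[m∸1] (suc m) = ≤-refl
    top : ∀ w → level (next w) ≡ n ∸ 1 → level (next z) ≡ n ∸ 1
    top w lw with w ≟ᶠ z
    ... | yes refl = lw
    ... | no w≢z   = ⊥-elim (<⇒≱ (level<n w)
      (≤-trans (m≤1+[m∸1] n) (≤-reflexive (≡-sym (trans (level-next w w≢z) (cong suc lw))))))

  -- `next` lowers the level and so runs against `Step`; the edge leaving `z` becomes the wraparound
  -- from n - 1 to 0.
  next⇒Step : ∀ i j → next (vertex j) ≡ vertex i → Step i j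
  next⇒Step i j e with vertex j ≟ᶠ z
  ... | no j≢z = inj₁ (trans (≡-sym (level-vertex j))
          (trans (level-next (vertex j) j≢z) (cong suc (trans (cong level e) (level-vertex i)))))
  ... | yes j≡z = inj₂ (trans (≡-sym (level-vertex i))
          (trans (cong level (trans (≡-sym e) (cong next j≡z))) level-next-z) ,
          trans (≡-sym (level-vertex j)) (trans (cong level j≡z) level-z))

  Step⇒next : ∀ i j → Step i j → next (vertex j) ≡ vertex i
  Step⇒next i j (inj₁ e) = level-injective (toℕ i) (level-pred (trans (level-vertex j) e)) (level-vertex i)
  Step⇒next i j (inj₂ (l , e)) = level-injective (n ∸ 1)
    (trans (cong (level ∘ next) (level-0⇒z (trans (level-vertex j) e))) level-next-z)
    (trans (level-vertex i) l)

  degree≤2⇒cycleGraph : IsCycleGraph G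
  degree≤2⇒cycleGraph = mk↔ₛ′ vertex position
      (λ v → position-injective (position-vertex (position v))) position-vertex ,
    λ i j → bool-ext
      (λ e → case adj-next e of λ
        { (inj₁ p) → ∨-introʳ {step i j} (step-intro j i (next⇒Step j i p))
        ; (inj₂ p) → ∨-introˡ (step-intro i j (next⇒Step i j p)) })
      (λ s → case ∨-elim {step i j} s of λ
        { (inj₁ p) → adj-sym G _ _ (edge (Step⇒next i j (step-elim i j p)))
        ; (inj₂ p) → edge (Step⇒next j i (step-elim j i p)) })
    where
    edge : ∀ {u v} → next u ≡ v → adj G u v ≡ true
    edge {u} refl = next-adj u

-- Arithmetic

halve-≤ : ∀ {m w} → m + m ≤ suc (w + w) → m ≤ w
halve-≤ {m} {w} h with m ≤? w
... | yes p = p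
... | no  p = contradiction h (<⇒≱ (begin-strict
  suc (w + w)      <⟨ n<1+n _ ⟩
  suc (suc w + w)  ≡⟨ +-suc (suc w) w ⟨
  suc w + suc w    ≤⟨ +-mono-≤ (≰⇒> p) (≰⇒> p) ⟩
  m + m            ∎))
  where open ≤-Reasoning

-- Both parities are treated at once: c = 0, j = 2 for n = 2m + 1 and c = 1, j = 1 for n = 2m.
module Bounds {n m c j : ℕ} (n-eq : n + c ≡ suc (m + m)) (j-eq : j + c ≡ 2) (c≤1 : c ≤ 1) where

  private
    variable
      x w t : ℕ

  -- Meant for the complement of an independent set. From `m ≤ w` and x = n - w one gets x + t ≤ n -
  -- m + 1, which equals `j + m`.
  upper-bound : t ≤ 1 → x + w ≡ n → n ≤ suc (w + w) → m ≤ w × x + t ≤ j + m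
  upper-bound {t} {x} {w} t≤1 refl n≤ = m≤w , +-cancelʳ-≤ (w + c) _ _ (begin
    x + t + (w + c)      ≡⟨ solve 4 (λ x t w c → x :+ t :+ (w :+ c) := t :+ (x :+ w :+ c)) refl x t w c ⟩
    t + (x + w + c)      ≤⟨ +-monoˡ-≤ _ t≤1 ⟩
    1 + (x + w + c)      ≡⟨ cong suc n-eq ⟩
    2 + (m + m)          ≤⟨ +-monoʳ-≤ 2 (+-monoʳ-≤ m m≤w) ⟩
    2 + (m + w)          ≡⟨ cong (_+ (m + w)) j-eq ⟨
    j + c + (m + w)      ≡⟨ solve 4 (λ j c m w → j :+ c :+ (m :+ w) := j :+ m :+ (w :+ c)) refl j c m w ⟩
    j + m + (w + c)      ∎)
    where
    open ≤-Reasoning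
    open +-*-Solver
    m≤w : m ≤ w
    m≤w = halve-≤ (≤-pred (begin
      suc (m + m)        ≡⟨ n-eq ⟨
      x + w + c          ≤⟨ +-mono-≤ n≤ c≤1 ⟩
      suc (w + w) + 1    ≡⟨ +-comm _ 1 ⟩
      2 + (w + w)        ∎))

  lower-bound : 1 ≤ t → x + (w + t) ≤ suc n → (t ≤ 1 → n ≤ x + w) →
                w ≤ x + c ⊎ (3 ≤ t × w ≤ suc (x + c)) → w ≤ m × w + j ≤ x + t
  lower-bound {t} {x} {w} 1≤t size τ1 bound = w≤m , +-cancelʳ-≤ c _ _ (begin
    w + j + c    ≡⟨ +-assoc w j c ⟩
    w + (j + c)  ≡⟨ cong (w +_) j-eq ⟩
    w + 2        ≤⟨ w+2≤ ⟩
    x + c + t    ≡⟨ solve 3 (λ x c t → x :+ c :+ t := x :+ t :+ c) refl x c t ⟩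
    x + t + c    ∎)
    where
    open ≤-Reasoning
    open +-*-Solver
    -- s = 1 if some component has no exit, and s = 0 otherwise.
    big : ∀ s → 2 + s ≤ t → w ≤ s + (x + c) → w ≤ m × w + 2 ≤ x + c + t
    big s s≤t w≤ = halve-≤ (≤-trans (+-cancelʳ-≤ (2 + s) _ _ (begin
        w + w + (2 + s)              ≤⟨ +-mono-≤ (+-monoˡ-≤ w w≤) s≤t ⟩
        s + (x + c) + w + t
          ≡⟨ solve 5 (λ s x c w t → s :+ (x :+ c) :+ w :+ t := s :+ c :+ (x :+ (w :+ t))) refl s x c w t ⟩
        s + c + (x + (w + t))        ≤⟨ +-monoʳ-≤ (s + c) size ⟩
        s + c + suc n
          ≡⟨ solve 3 (λ s c n → s :+ c :+ (con 1 :+ n) := con 1 :+ s :+ (n :+ c)) refl s c n ⟩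
        1 + s + (n + c)              ≡⟨ cong (1 + s +_) n-eq ⟩
        1 + s + suc (m + m)
          ≡⟨ solve 2 (λ s m → con 1 :+ s :+ (con 1 :+ (m :+ m)) := m :+ m :+ (con 2 :+ s)) refl s m ⟩
        m + m + (2 + s)              ∎)) (n≤1+n _)) ,
      (begin
        w + 2                        ≤⟨ +-monoˡ-≤ 2 w≤ ⟩
        s + (x + c) + 2
          ≡⟨ solve 3 (λ s x c → s :+ (x :+ c) :+ con 2 := x :+ c :+ (con 2 :+ s)) refl s x c ⟩
        x + c + (2 + s)              ≤⟨ +-monoʳ-≤ (x + c) s≤t ⟩
        x + c + t                    ∎)
    -- All components are single vertices, so `x + w` is n. Parity gives `w ≤ m`, hence `x + c` is
    -- at least `suc m`, which makes up for the small `t`.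
    small : t ≤ 1 → w ≤ x + c → w ≤ m × w + 2 ≤ x + c + t
    small t≤1 w≤ = w≤m′ , (begin
        w + 2                        ≤⟨ +-monoˡ-≤ 2 w≤m′ ⟩
        m + 2                        ≡⟨ +-suc m 1 ⟩
        suc m + 1                    ≤⟨ +-mono-≤ m<x+c 1≤t ⟩
        x + c + t                    ∎)
      where
      x+w≡n : x + w ≤ n
      x+w≡n = ≤-pred (begin
        suc (x + w)                  ≡⟨ +-comm 1 (x + w) ⟩
        x + w + 1                    ≤⟨ +-monoʳ-≤ (x + w) 1≤t ⟩
        x + w + t                    ≡⟨ +-assoc x w t ⟩
        x + (w + t)                  ≤⟨ size ⟩
        suc n                        ∎)
      w≤m′ : w ≤ m
      w≤m′ = halve-≤ (begin
        w + w                        ≤⟨ +-monoˡ-≤ w w≤ ⟩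
        x + c + w                    ≡⟨ solve 3 (λ x c w → x :+ c :+ w := x :+ w :+ c) refl x c w ⟩
        x + w + c                    ≤⟨ +-monoˡ-≤ c x+w≡n ⟩
        n + c                        ≡⟨ n-eq ⟩
        suc (m + m)                  ∎)
      m<x+c : suc m ≤ x + c
      m<x+c = +-cancelʳ-≤ m _ _ (begin
        suc (m + m)                  ≡⟨ n-eq ⟨
        n + c                        ≤⟨ +-monoˡ-≤ c (τ1 t≤1) ⟩
        x + w + c                    ≡⟨ solve 3 (λ x c w → x :+ w :+ c := x :+ c :+ w) refl x c w ⟩
        x + c + w                    ≤⟨ +-monoʳ-≤ (x + c) w≤m′ ⟩
        x + c + m                    ∎)
    cases : w ≤ x + c ⊎ (3 ≤ t × w ≤ suc (x + c)) → w ≤ m × w + 2 ≤ x + c + t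
    cases (inj₂ (3≤t , w≤)) = big 1 3≤t w≤
    cases (inj₁ w≤) with t ≤? 1
    ... | yes t≤1 = small t≤1 w≤
    ... | no  t≰1 = big 0 (≰⇒> t≰1) w≤
    w≤m : w ≤ m
    w≤m = proj₁ (cases bound)
    w+2≤ : w + 2 ≤ x + c + t
    w+2≤ = proj₂ (cases bound)

  -- In fractions: (x + t)/w ≥ 1 + j/w ≥ 1 + j/m.
  cross-lower : w ≤ m × w + j ≤ x + t → (j + m) * w ≤ (x + t) * m
  cross-lower {w} {x} {t} (w≤m , h) = begin
    (j + m) * w    ≡⟨ *-distribʳ-+ w j m ⟩
    j * w + m * w  ≤⟨ +-mono-≤ (*-monoʳ-≤ j w≤m) (≤-reflexive (*-comm m w)) ⟩
    j * m + w * m  ≡⟨ +-comm (j * m) (w * m) ⟩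
    w * m + j * m  ≡⟨ *-distribʳ-+ m w j ⟨
    (w + j) * m    ≤⟨ *-monoˡ-≤ m h ⟩
    (x + t) * m    ∎
    where open ≤-Reasoning

  -- The hypotheses give x + t < w + j, so j m < j w + m suffices. For j = 1 this is 0 < w; for j =
  -- 2 it is m < 2w, which follows from `n ≤ x + (w + w)` and x < w.
  cross-strict : x + suc c ≤ w → t ≤ 2 → n ≤ x + (w + w) → (x + t) * m < (j + m) * w
  cross-strict {x} {w} {t} h t≤2 n≤ = +-cancelʳ-≤ m _ _ (begin
    suc ((x + t) * m) + m        ≡⟨ cong suc (+-comm _ m) ⟩
    suc (suc (x + t) * m)        ≤⟨ s≤s (*-monoˡ-≤ m x+t<) ⟩
    suc ((w + j) * m)            ≡⟨ cong suc (*-distribʳ-+ m w j) ⟩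
    suc (w * m + j * m)          ≡⟨ +-suc (w * m) (j * m) ⟨
    w * m + suc (j * m)          ≤⟨ +-monoʳ-≤ (w * m) (jm< j c j-eq refl) ⟩
    w * m + (j * w + m)          ≡⟨ solve 3 (λ w m j → w :* m :+ (j :* w :+ m) := (j :+ m) :* w :+ m) refl w m j ⟩
    (j + m) * w + m              ∎)
    where
    open ≤-Reasoning
    open +-*-Solver
    x+t< : suc (x + t) ≤ w + j
    x+t< = begin
      suc (x + t)        ≤⟨ s≤s (+-monoʳ-≤ x t≤2) ⟩
      suc (x + 2)        ≡⟨ cong (λ k → suc (x + k)) j-eq ⟨
      suc (x + (j + c))  ≡⟨ solve 3 (λ x j c → con 1 :+ (x :+ (j :+ c)) := x :+ (con 1 :+ c) :+ j) refl x j c ⟩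
      x + suc c + j      ≤⟨ +-monoˡ-≤ j h ⟩
      w + j              ∎
    1≤w : 1 ≤ w
    1≤w = ≤-trans (s≤s z≤n) (≤-trans (m≤n+m (suc c) x) h)
    x<w : suc x ≤ w
    x<w = ≤-trans (≤-trans (s≤s (m≤m+n x c)) (≤-reflexive (≡-sym (+-suc x c)))) h
    m<2w : c ≡ 0 → suc m ≤ w + w
    m<2w refl = halve-≤ (begin
      suc m + suc m              ≡⟨ cong suc (+-suc m m) ⟩
      suc (suc (m + m))          ≡⟨ cong suc (trans (≡-sym n-eq) (+-identityʳ n)) ⟩
      suc n                      ≤⟨ s≤s n≤ ⟩
      suc x + (w + w)            ≤⟨ +-monoˡ-≤ (w + w) (≤-trans x<w (m≤m+n w w)) ⟩
      w + w + (w + w)            ≤⟨ n≤1+n _ ⟩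
      suc (w + w + (w + w))      ∎)
    jm< : ∀ j c′ → j + c′ ≡ 2 → c′ ≡ c → suc (j * m) ≤ j * w + m
    jm< 0 _ refl refl = contradiction c≤1 λ { (s≤s ()) }
    jm< 1 _ _ _ = ≤-trans (+-mono-≤ 1≤w (≤-reflexive (+-identityʳ m)))
                    (≤-reflexive (cong (_+ m) (≡-sym (+-identityʳ w))))
    jm< 2 0 _ c≡0 = begin
      suc (2 * m)                ≡⟨ cong (λ k → suc (m + k)) (+-identityʳ m) ⟩
      suc m + m                  ≤⟨ +-monoˡ-≤ m (m<2w (≡-sym c≡0)) ⟩
      w + w + m                  ≡⟨ cong (λ k → w + k + m) (+-identityʳ w) ⟨
      2 * w + m                  ∎

-- The extremal value and the two parities

module Extremal {n m c j : ℕ} (4≤n : 4 ≤ n) (2≤m : 2 ≤ m)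
  (n-eq : n + c ≡ suc (m + m)) (j-eq : j + c ≡ 2) (c≤1 : c ≤ 1) where

  open Bounds {n} {m} {c} {j} n-eq j-eq c≤1

  -- (n + 3)/(n - 1) for odd n and (n + 2)/n for even n.
  extremal : ℚᵘ
  extremal = frac (j + m) m

  1≤m : 1 ≤ m
  1≤m = ≤-trans (n≤1+n 1) 2≤m

  -- Used twice: to bound the tenacity from above, and to show that the minimum defining it runs
  -- over a nonempty list.
  small-cut : ∀ (H : Graph n) → Unicyclic H → ∃ λ X → 1 < ω H X × ratio H X ≤ℚ extremal
  small-cut H uni with independent-cut H (orientation H uni)
  ... | X , τ≤1 , size , n≤ with upper-bound τ≤1 size n≤
  ...   | m≤ω , X+τ≤ = X , ≤-trans 2≤m m≤ω ,
            frac-≤ {count X + τ H X} {ω H X} {j + m} {m} (≤-trans 1≤m m≤ω) 1≤m (*-mono-≤ X+τ≤ m≤ω)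

  tenacity≤extremal : ∀ (H : Graph n) → Unicyclic H → tenacity H ≤ℚ extremal
  tenacity≤extremal H uni with small-cut H uni
  ... | X , 1<ω , h = ℚ.≤-trans (tenacity≤ratio H X 1<ω) h

  extremal≤tenacity : ∀ (G : Graph n) (uni : Unicyclic G) →
    (∀ X → count (Exits.exit G (orientation G uni) X) ≤ count X + c) → extremal ≤ℚ tenacity G
  extremal≤tenacity G uni exits≤ = ≤tenacity G (proj₁ cut) (proj₁ (proj₂ cut)) bound
    where
    cut : ∃ λ X → 1 < ω G X × ratio G X ≤ℚ extremal
    cut = small-cut G uni
    bound : ∀ Y → 1 < ω G Y → extremal ≤ℚ ratio G Y
    bound Y 1<ω = frac-≤ {j + m} {m} {count Y + τ G Y} {ω G Y} 1≤m 1≤ω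
      (cross-lower {ω G Y} {count Y} {τ G Y} (lower-bound (ω≥1⇒τ≥1 1≤ω) |X|+ω+τ≤1+n τ≤1⇒n≤|X|+ω few))
      where
      open Components G Y
      open Exits G (orientation G uni) Y using (ω-bound)
      1≤ω : 1 ≤ ω G Y
      1≤ω = ≤-trans (n≤1+n 1) 1<ω
      few : ω G Y ≤ count Y + c ⊎ (3 ≤ τ G Y × ω G Y ≤ suc (count Y + c))
      few with ω-bound
      ... | inj₁ h        = inj₁ (≤-trans h (exits≤ Y))
      ... | inj₂ (3≤τ , h) = inj₂ (3≤τ , ≤-trans h (s≤s (exits≤ Y)))

  surplus⇒¬extremal : ∀ (G : Graph n) (O : Orientation G) S → 1 ≤ count S → Greedy.Surplus G O (suc c) S →
                      ¬ extremal ≤ℚ tenacity G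
  surplus⇒¬extremal G O S 1≤S s h with Greedy.surplus-cut G O S s
  ... | X , S≤X , τ≤2 , X≤ω , n≤ = <⇒≱ (cross-strict {count X} {ω G X} {τ G X} X≤ω τ≤2 n≤)
    (frac-≤⁻¹ {j + m} {m} {count X + τ G X} {ω G X} 1≤m (≤-trans (n≤1+n 1) 1<ω)
      (ℚ.≤-trans h (tenacity≤ratio G X 1<ω)))
    where
    -- `X` has at least one vertex because `S` has, and the surplus `suc c` adds at least one more.
    1<ω : 1 < ω G X
    1<ω = ≤-trans (+-mono-≤ (≤-trans 1≤S S≤X) (s≤s z≤n)) X≤ω

  extremal≤⇒max : ∀ (G : Graph n) → extremal ≤ℚ tenacity G → MaxTenacityUnicyclic G
  extremal≤⇒max G h H uni = ℚ.≤-trans (tenacity≤extremal H uni) h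

  -- Maximum degree 2 bounds the exits by |X|, which suffices for `c = 0` and `c = 1` alike; so the
  -- cycle is a common reference graph for both parities.
  cycleGraph-extremal : ∀ (G : Graph n) → Unicyclic G → IsCycleGraph G → extremal ≤ℚ tenacity G
  cycleGraph-extremal G uni isCycle = extremal≤tenacity G uni (λ X → ≤-trans
    (Exits.exits≤|X| G (orientation G uni) X (cycleGraph-degree≤2 G isCycle)) (+-monoʳ-≤ (count X) z≤n))

  max⇒extremal≤ : ∀ (G : Graph n) → MaxTenacityUnicyclic G → extremal ≤ℚ tenacity G
  max⇒extremal≤ G maximal = ℚ.≤-trans
    (cycleGraph-extremal (cycleGraph n 3≤n) (cycleGraph-unicyclic n 3≤n) (cycleGraph-isCycleGraph n 3≤n))
    (maximal (cycleGraph n 3≤n) (cycleGraph-unicyclic n 3≤n))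
    where
    3≤n : 3 ≤ n
    3≤n = ≤-trans (n≤1+n 3) 4≤n

insert-nonempty : ∀ {n} (X : VSet n) v → 1 ≤ count (insert X v)
insert-nonempty X v = count≥1 {P = insert X v} {v} (insert-new X v)

module _ {n m : ℕ} (4≤n : 4 ≤ n) (2≤m : 2 ≤ m) (G : Graph n) (uni : Unicyclic G) where

  private
    O : Orientation G
    O = orientation G uni
    open Greedy G O

  odd-case : n ≡ suc (m + m) → MaxTenacityUnicyclic G ⇔ IsCycleGraph G
  odd-case n-eq = mk⇔
    (λ maximal → degree≤2⇒cycleGraph G O (λ v → ≮⇒≥ (λ 3≤d →
      surplus⇒¬extremal G O _ (insert-nonempty _ v) (surplus-degree 1 v 3≤d) (max⇒extremal≤ G maximal))))
    (λ isCycle → extremal≤⇒max G (cycleGraph-extremal G uni isCycle))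
    where open Extremal {n} {m} {0} {2} 4≤n 2≤m (trans (+-identityʳ n) n-eq) refl z≤n

  even-case : n ≡ m + m → MaxTenacityUnicyclic G ⇔ EvenCondition G
  even-case n-eq = mk⇔
    (λ maximal → (λ v → ≮⇒≥ (λ 4≤d →
        surplus⇒¬extremal G O _ (insert-nonempty _ v) (surplus-degree 2 v 4≤d) (max⇒extremal≤ G maximal))) ,
      (λ u v u≢v du dv → case bool-cases (adj G u v) of λ
        { (inj₁ e)  → e
        ; (inj₂ ¬e) → ⊥-elim (surplus⇒¬extremal G O _ (insert-nonempty _ v)
            (surplus-pair u v u≢v (trans (Graph.sym G v u) ¬e) (≤-reflexive (≡-sym du)) (≤-reflexive (≡-sym dv)))
            (max⇒extremal≤ G maximal)) }))
    (λ cond → extremal≤⇒max G (extremal≤tenacity G uni (λ X → Exits.exits≤1+|X| G O X cond)))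
    where open Extremal {n} {m} {1} {1} 4≤n 2≤m (trans (+-comm n 1) (cong suc n-eq)) refl ≤-refl

theorem3 : (n : ℕ) → 4 ≤ n → (G : Graph n) → Unicyclic G →
    ((n % 2 ≡ 1 → (MaxTenacityUnicyclic G ⇔ IsCycleGraph G)) ×
    (n % 2 ≡ 0 → (MaxTenacityUnicyclic G ⇔ EvenCondition G)))
theorem3 n 4≤n G uni =
  (λ odd  → odd-case 4≤n (half-≥2 (≤-reflexive odd)) G uni (halves odd)) ,
  (λ even → even-case 4≤n (half-≥2 (≤-trans (≤-reflexive even) z≤n)) G uni (halves even))
  where
  m : ℕ
  m = n / 2
  halves : ∀ {r} → n % 2 ≡ r → n ≡ r + (m + m)
  halves refl = trans (m≡m%n+[m/n]*n n 2) (cong (n % 2 +_) (trans (*-comm m 2) (cong (m +_) (+-identityʳ m))))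
  half-≥2 : n % 2 ≤ 1 → 2 ≤ m
  half-≥2 r≤1 = halve-≤ (≤-trans 4≤n (≤-trans (≤-reflexive (halves refl)) (+-monoˡ-≤ (m + m) r≤1)))
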